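{- The Lagrange spectrum of $\mathbb{Q}((1/T))$ equals $$\{L(A): A=(g_i)_{i\in\mathbb{Z}} \text{ a doubly infinite sequence of polynomials } g_i\in\mathbb{Q}[T] \text{ with } \deg g_i\ge1\}.$$
   Context: $\mathbb{Q}((1/T))$ is the field of formal Laurent series in $1/T$ over $\mathbb{Q}$; $\deg$ of a nonzero series is the exponent of its leading term, $\deg0=-\infty$. For polynomials $c_0,c_1,\dots$ with $\deg c_j\ge1$ for $j\ge1$, $[c_0,c_1,c_2,\dots]=c_0+\cfrac{1}{c_1+\cfrac{1}{c_2+\cdots}}$ converges in $\mathbb{Q}((1/T))$. For a doubly infinite sequence $A=(g_i)_{i\in\mathbb{Z}}$ of polynomials of positive degree, $\lambda_i(A)=[g_i,g_{i+1},\dots]+[0,g_{i-1},g_{i-2},\dots]$ and $L(A)=\limsup_{|i|\to\infty}\deg\lambda_i(A)$ (the larger of the limsups as $i\to+\infty$ and $i\to-\infty$), a value in $\mathbb{Z}\cup\{\infty\}$. Lagrange spectrum: for $\alpha\notin\mathbb{Q}(T)$, $l(\alpha)\in\mathbb{Z}\cup\{\infty\}$ is the supremum of integers $k$ such that $\deg(\alpha-p/q)\le-2\deg q-k$ for infinitely many $p,q\in\mathbb{Q}[T]$, $q\neq0$; the Lagrange spectrum is $\{l(\alpha):\alpha\in\mathbb{Q}((1/T))\setminus\mathbb{Q}(T)\}$. -}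

module Defs where

open import Data.Integer as ℤ using (ℤ; +_; -[1+_]; 0ℤ; 1ℤ; ∣_∣)
import Data.Integer.Properties as ℤ
open import Data.List using (List; []; _∷_; length)
open import Data.List.Relation.Unary.Any using (Any)
open import Data.Nat as ℕ using (ℕ; zero; suc)
open import Data.Product using (Σ; ∃; ∃₂; _×_; _,_; proj₁; proj₂)
open import Data.Rational as ℚ using (ℚ; 0ℚ)
import Data.Rational.Properties as ℚ
open import Data.Vec as Vec using (Vec; []; _∷_)
open import Function using (_∘_)
open import Level using (0ℓ)
open import Relation.Binary.Construct.Add.Supremum.NonStrict ℤ._≤_ using (_≤⁺_)
open import Relation.Binary.PropositionalEquality
open import Relation.Nullary using (¬_; contradiction)
open import Relation.Nullary.Construct.Add.Supremum using (_⁺; [_])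
open import Relation.Unary using (Pred)

------------------------------------------------------------------------
-- The field ℚ((1/T))

infix  4 _≈_
infixl 6 _⊕_ _⊖_
infixl 7 _⊗_

-- The series Σₙ digits(n) T^(top - n).  The digit at `top` may vanish, so
-- that a series has many representations; they are compared by _≈_.
record Laurent : Set where
  constructor laurent
  field
    top    : ℤ
    digits : ℕ → ℚ

open Laurent public

digitAt : (ℕ → ℚ) → ℤ → ℚ
digitAt a (+ n)    = a n
digitAt a -[1+ n ] = 0ℚ

-- The coefficient of T^j.
coeff : Laurent → ℤ → ℚ
coeff f j = digitAt (digits f) (top f ℤ.- j)

_≈_ : Laurent → Laurent → Set
f ≈ g = ∀ j → coeff f j ≡ coeff g j

_⊕_ : Laurent → Laurent → Laurent
f ⊕ g = laurent m λ n → coeff f (m ℤ.- + n) ℚ.+ coeff g (m ℤ.- + n)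
  where m = top f ℤ.⊔ top g

neg : Laurent → Laurent
neg f = laurent (top f) (λ n → ℚ.- digits f n)

_⊖_ : Laurent → Laurent → Laurent
f ⊖ g = f ⊕ neg g

-- Σ_{k<n} a(k) x(k).
dot : ∀ {n} → (ℕ → ℚ) → Vec ℚ n → ℚ
dot a []       = 0ℚ
dot a (x ∷ xs) = a 0 ℚ.* x ℚ.+ dot (a ∘ suc) xs

-- The vector b(n), …, b(1), b(0).
downFrom : (ℕ → ℚ) → ∀ n → Vec ℚ (suc n)
downFrom b zero    = b 0 ∷ []
downFrom b (suc n) = b (suc n) ∷ downFrom b n

-- Cauchy product.
_⊗_ : Laurent → Laurent → Laurent
f ⊗ g = laurent (top f ℤ.+ top g) λ n → dot (digits f) (downFrom (digits g) n)

------------------------------------------------------------------------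
-- Degree

HasDegree : Laurent → ℤ → Set
HasDegree f d = coeff f d ≢ 0ℚ × (∀ j → d ℤ.< j → coeff f j ≡ 0ℚ)

-- deg f ≤ m, including the case f = 0 of degree -∞.
Deg≤ : Laurent → ℤ → Set
Deg≤ f m = ∀ j → m ℤ.< j → coeff f j ≡ 0ℚ

Deg≤⇒≤ : ∀ f {d m} → HasDegree f d → Deg≤ f m → d ℤ.≤ m
Deg≤⇒≤ f (lead , _) f≤m = ℤ.≮⇒≥ λ m<d → lead (f≤m _ m<d)

≤⇒Deg≤ : ∀ f {d m} → HasDegree f d → d ℤ.≤ m → Deg≤ f m
≤⇒Deg≤ f (_ , f≤d) d≤m j m<j = f≤d j (ℤ.≤-<-trans d≤m m<j)

-- Being nonzero, in the positive form that locates the leading term.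
Nonzero : Laurent → Set
Nonzero f = ∃ λ d → HasDegree f d

PositiveDegree : Laurent → Set
PositiveDegree f = ∃ λ d → HasDegree f d × 1ℤ ℤ.≤ d

------------------------------------------------------------------------
-- Inverses

-- If u a(0) = 1, then Σ b(n) xⁿ inverts Σ a(n) xⁿ, where b(0) = u and
-- b(n+1) = - u Σ_{k≤n} a(k+1) b(n-k).  This is the vector b(n), …, b(0).
invDigits : ℚ → (ℕ → ℚ) → ∀ n → Vec ℚ (suc n)
invDigits u a zero    = u ∷ []
invDigits u a (suc n) = ℚ.- (u ℚ.* dot (a ∘ suc) bs) ∷ bs
  where bs = invDigits u a n

inv : ∀ f → Nonzero f → Laurent
inv f (d , lead , _) = laurent (ℤ.- d) λ n →
  Vec.head (invDigits (ℚ.1/_ (coeff f d) {{ℚ.≢-nonZero lead}})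
                      (λ k → coeff f (d ℤ.- + k)) n)

inv⁺ : ∀ f → PositiveDegree f → Laurent
inv⁺ f (d , f-d , _) = inv f (d , f-d)

------------------------------------------------------------------------
-- Polynomials

-- A list of coefficients, the constant one first.
Poly : Set
Poly = List ℚ

polyCoeff : Poly → ℕ → ℚ
polyCoeff []      n       = 0ℚ
polyCoeff (a ∷ p) zero    = a
polyCoeff (a ∷ p) (suc n) = polyCoeff p n

ι : Poly → Laurent
ι p = laurent (+ length p) λ n → digitAt (polyCoeff p) (+ length p ℤ.- + n)

Poly⁺ : Set
Poly⁺ = Σ Poly λ p → PositiveDegree (ι p)

-- p/q with q ≠ 0, not necessarily in lowest terms.
record Fraction : Set where
  constructor fraction
  field
    num den : Poly
    den≢0   : Nonzero (ι den)

  value : Laurent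
  value = ι num ⊗ inv (ι den) den≢0

  degDen : ℤ
  degDen = proj₁ den≢0

open Fraction public

Rational : Laurent → Set
Rational α = ∃ λ r → α ≈ value r

------------------------------------------------------------------------
-- The Lagrange spectrum

-- Not finite.  Fractions are counted by their values: multiplying p and q
-- by constants turns any single pair into infinitely many.
InfinitelyMany : Pred Fraction 0ℓ → Set
InfinitelyMany P =
  ¬ (∃ λ (rs : List Fraction) → ∀ r → P r → Any (λ s → value r ≈ value s) rs)

-- deg (α - p/q) ≤ - 2 deg q - k.
Approximates : Laurent → ℤ → Pred Fraction 0ℓ
Approximates α k r = Deg≤ (α ⊖ value r) (ℤ.- (+ 2 ℤ.* degDen r) ℤ.- k)

IsSupremum : Pred ℤ 0ℓ → ℤ ⁺ → Set
IsSupremum S v = (∀ k → S k → [ k ] ≤⁺ v)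
               × (∀ w → (∀ k → S k → [ k ] ≤⁺ w) → v ≤⁺ w)

IsInfimum : Pred ℤ 0ℓ → ℤ ⁺ → Set
IsInfimum S v = (∀ k → S k → v ≤⁺ [ k ])
              × (∀ w → (∀ k → S k → w ≤⁺ [ k ]) → w ≤⁺ v)

-- l(α) = v.
IsLagrangeValue : Laurent → ℤ ⁺ → Set
IsLagrangeValue α = IsSupremum (λ k → InfinitelyMany (Approximates α k))

LagrangeSpectrum : Pred (ℤ ⁺) 0ℓ
LagrangeSpectrum v = ∃ λ α → ¬ Rational α × IsLagrangeValue α v

------------------------------------------------------------------------
-- Continued fractions

coeff-above-top : ∀ f j → top f ℤ.< j → coeff f j ≡ 0ℚ
coeff-above-top f j top<j with top f ℤ.- j in eq
... | -[1+ n ] = refl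
... | + n      = contradiction
  (ℤ.0≤i-j⇒j≤i (subst (0ℤ ℤ.≤_) (sym eq) (ℤ.+≤+ ℕ.z≤n))) (ℤ.<⇒≱ top<j)

coeff-⊕ : ∀ f g j → coeff (f ⊕ g) j ≡ coeff f j ℚ.+ coeff g j
coeff-⊕ f g j with (top f ℤ.⊔ top g) ℤ.- j in eq
... | + n      = cong (λ i → coeff f i ℚ.+ coeff g i) m-n≡j
  where
  m = top f ℤ.⊔ top g
  m-n≡j : m ℤ.- + n ≡ j
  m-n≡j = begin
    m ℤ.- + n                     ≡⟨ cong (λ x → m ℤ.- x) (sym eq) ⟩
    m ℤ.- (m ℤ.- j)               ≡⟨ cong (λ x → m ℤ.+ x) (ℤ.neg-distrib-+ m (ℤ.- j)) ⟩
    m ℤ.+ (ℤ.- m ℤ.+ ℤ.- (ℤ.- j)) ≡⟨ sym (ℤ.+-assoc m (ℤ.- m) _) ⟩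
    m ℤ.- m ℤ.+ ℤ.- (ℤ.- j)       ≡⟨ cong₂ ℤ._+_ (ℤ.+-inverseʳ m) (ℤ.neg-involutive j) ⟩
    0ℤ ℤ.+ j                      ≡⟨ ℤ.+-identityˡ j ⟩
    j                             ∎
    where open ≡-Reasoning
... | -[1+ n ] = sym (cong₂ ℚ._+_
  (coeff-above-top f j (ℤ.≤-<-trans (ℤ.i≤i⊔j (top f) (top g)) m<j))
  (coeff-above-top g j (ℤ.≤-<-trans (ℤ.i≤j⊔i (top f) (top g)) m<j)))
  where
  m<j : top f ℤ.⊔ top g ℤ.< j
  m<j = ℤ.≰⇒> λ j≤m → contradiction (subst (0ℤ ℤ.≤_) eq (ℤ.i≤j⇒0≤j-i j≤m)) λ ()

-- Adding 1/g to f does not change the leading term of f.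
⊕-inv-positive : ∀ f g → PositiveDegree f → (g⁺ : PositiveDegree g) →
                 PositiveDegree (f ⊕ inv⁺ g g⁺)
⊕-inv-positive f g (d , (lead , above) , 1≤d) g⁺@(e , _ , 1≤e) =
  d , ((λ eq → lead (trans (sym (same d ℤ.≤-refl)) eq)) ,
       λ j d<j → trans (same j (ℤ.<⇒≤ d<j)) (above j d<j)) , 1≤d
  where
  1/g = inv⁺ g g⁺

  same : ∀ j → d ℤ.≤ j → coeff (f ⊕ 1/g) j ≡ coeff f j
  same j d≤j = begin
    coeff (f ⊕ 1/g) j           ≡⟨ coeff-⊕ f 1/g j ⟩
    coeff f j ℚ.+ coeff 1/g j   ≡⟨ cong (coeff f j ℚ.+_) (coeff-above-top 1/g j -e<j) ⟩
    coeff f j ℚ.+ 0ℚ            ≡⟨ ℚ.+-identityʳ (coeff f j) ⟩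
    coeff f j                   ∎
    where
    open ≡-Reasoning
    -e<j : ℤ.- e ℤ.< j
    -e<j = ℤ.≤-<-trans (ℤ.neg-mono-≤ 1≤e)
             (ℤ.<-≤-trans ℤ.-<+ (ℤ.≤-trans 1≤d d≤j))

-- [c(0), …, c(n)], which has positive degree and so may be inverted.
tail : (ℕ → Poly⁺) → ℕ → Σ Laurent PositiveDegree
tail c zero    = ι (proj₁ (c 0)) , proj₂ (c 0)
tail c (suc n) =
  let p , p⁺ = c 0
      y , y⁺ = tail (c ∘ suc) n
  in ι p ⊕ inv⁺ y y⁺ , ⊕-inv-positive (ι p) y p⁺ y⁺

-- [c₀, c(0), …, c(n-1)].
convergent : Poly → (ℕ → Poly⁺) → ℕ → Laurent
convergent c₀ c zero    = ι c₀
convergent c₀ c (suc n) =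
  let y , y⁺ = tail c n in ι c₀ ⊕ inv⁺ y y⁺

ConvergesTo : (ℕ → Laurent) → Laurent → Set
ConvergesTo x y = ∀ m → ∃ λ N → ∀ n → N ℕ.≤ n → Deg≤ (x n ⊖ y) m

-- [c₀, c(0), c(1), …] = x.
IsContinuedFraction : Poly → (ℕ → Poly⁺) → Laurent → Set
IsContinuedFraction c₀ c = ConvergesTo (convergent c₀ c)

------------------------------------------------------------------------
-- Doubly infinite sequences

-- λᵢ(A) = s.
Isλ : (ℤ → Poly⁺) → ℤ → Laurent → Set
Isλ A i s = ∃₂ λ x y →
    IsContinuedFraction (proj₁ (A i)) (λ n → A (i ℤ.+ + suc n)) x
  × IsContinuedFraction []            (λ n → A (i ℤ.- + suc n)) y
  × s ≈ x ⊕ y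

EventuallyBothWays : Pred ℤ 0ℓ → Set
EventuallyBothWays P = ∃ λ (N : ℕ) → ∀ i → N ℕ.≤ ∣ i ∣ → P i

-- limsup_{|i|→∞} deg s(i) = v, as the infimum of the eventual upper bounds.
IsLimsupDeg : (ℤ → Laurent) → ℤ ⁺ → Set
IsLimsupDeg s = IsInfimum (λ k → EventuallyBothWays (λ i → Deg≤ (s i) k))

-- L(A) = v.
IsL : (ℤ → Poly⁺) → ℤ ⁺ → Set
IsL A v = ∃ λ s → (∀ i → Isλ A i (s i)) × IsLimsupDeg s v

{-# OPTIONS --safe #-}
module Submission where

-- Both sets are {1, 2, 3, …} ∪ {∞}.  Since deg λᵢ(A) = deg gᵢ ≥ 1, the value
-- L(A) is at least 1, and A = (…, T^k, T^k, …) and gᵢ = T^(|i|+1) attain k and ∞.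
-- For the spectrum, everything follows from one identity: if α (c + β) = 1, then
--   (c q + p) α - q = α (p - q β),
-- so p/q ↦ q/(c q + p) carries approximations of β of quality m, meaning that
-- deg (β - p/q) ≤ - 2 deg q - m, to approximations of α of the same quality, and its
-- inverse carries those of α of quality > deg c back to β.
-- Going up along the continued fraction gives l(α) ≥ 1 for irrational α, and
-- approximations of quality deg cₙ to α = [0, c₀, c₁, …]; going down, deg q
-- decreases forever, so α admits no approximation of quality > max deg cₙ.

open import Defs
open import Algebra using (CommutativeRing)
import Algebra.Properties.Ring as RingProperties
open import Data.Integer as ℤ using (ℤ; +_; -[1+_]; 0ℤ; 1ℤ; -1ℤ; ∣_∣)
import Data.Integer.Properties as ℤ
open import Data.Integer.Tactic.RingSolver using (solve-∀)
open import Data.List as List using (List; []; _∷_; length; applyUpTo)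
import Data.List.Properties as List
open import Data.List.Relation.Unary.All as All using (All; []; _∷_)
open import Data.List.Relation.Unary.All.Properties using (All¬⇒¬Any)
open import Data.Nat as ℕ using (ℕ; zero; suc)
import Data.Nat.Properties as ℕ
open import Data.Product using (∃; _×_; _,_; proj₁; proj₂)
open import Data.Rational as ℚ using (ℚ; 0ℚ; 1ℚ)
import Data.Rational.Properties as ℚ
open import Data.Rational.Solver using (module +-*-Solver)
open import Data.Sum using (inj₁; inj₂)
open import Data.Vec as Vec using (_∷_)
open import Function using (_∘_; const)
open import Level using (0ℓ)
open import Relation.Binary using (tri<; tri≈; tri>)
open import Relation.Binary.Construct.Add.Supremum.NonStrict ℤ._≤_
  using (_≤⁺_; [_]; _≤⊤⁺; [≤]-injective)
open import Relation.Binary.PropositionalEquality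
import Relation.Binary.Reasoning.Setoid as SetoidReasoning
open import Relation.Nullary using (¬_; yes; no; contradiction)
open import Relation.Nullary.Construct.Add.Supremum using ([_]; ⊤⁺)
open import Relation.Unary using (_≐_)
open +-*-Solver using (_:+_; _:*_; :-_; _:=_; con) renaming (solve to solveℚ)

-- Two constructive obstacles shape the argument. Whether a Laurent series vanishes is undecidable,
-- so the expansion of a given α cannot be computed; but `InfinitelyMany` is a negation, so
-- approximations are needed only up to double negation, and an expansion step may assume that a
-- degree is known. Nor can l(α) be computed from α: a member of either set supplies its value v, an
-- integer v is used solely through 1 ≤ v, and the witness on the other side is then built from v
-- alone. Fractions are counted by value, so infinitude comes from irrationality: fractions with
-- ever larger denominators tend to α, while any finite list of values stays away from it. The
-- recurrences for p_n and q_n and the theorem on best approximations never appear; induction along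
-- the identity replaces them.

-- Cauchy products of digit sequences

Digits : Set
Digits = ℕ → ℚ

infixl 7 _∗_

_∗_ : Digits → Digits → Digits
(a ∗ b) n = dot a (downFrom b n)

unit : Digits
unit zero    = 1ℚ
unit (suc n) = 0ℚ

∗-cong : ∀ {a a′ b b′} → a ≗ a′ → b ≗ b′ → a ∗ b ≗ a′ ∗ b′
∗-cong a≗a′ b≗b′ zero    = cong₂ (λ x y → x ℚ.* y ℚ.+ 0ℚ) (a≗a′ 0) (b≗b′ 0)
∗-cong a≗a′ b≗b′ (suc n) =
  cong₂ ℚ._+_ (cong₂ ℚ._*_ (a≗a′ 0) (b≗b′ (suc n))) (∗-cong (a≗a′ ∘ suc) b≗b′ n)

∗-zeroˡ : ∀ {a} b → (∀ n → a n ≡ 0ℚ) → ∀ n → (a ∗ b) n ≡ 0ℚ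
∗-zeroˡ b a≗0 zero    rewrite a≗0 0 = trans (ℚ.+-identityʳ _) (ℚ.*-zeroˡ (b 0))
∗-zeroˡ b a≗0 (suc n) rewrite a≗0 0 =
  cong₂ ℚ._+_ (ℚ.*-zeroˡ (b (suc n))) (∗-zeroˡ b (a≗0 ∘ suc) n)

∗-identityˡ : ∀ b → unit ∗ b ≗ b
∗-identityˡ b zero    = trans (ℚ.+-identityʳ _) (ℚ.*-identityˡ (b 0))
∗-identityˡ b (suc n) = trans
  (cong₂ ℚ._+_ (ℚ.*-identityˡ (b (suc n))) (∗-zeroˡ b (λ _ → refl) n))
  (ℚ.+-identityʳ _)

∗-distribʳ : ∀ c a b n → ((λ i → a i ℚ.+ b i) ∗ c) n ≡ (a ∗ c) n ℚ.+ (b ∗ c) n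
∗-distribʳ c a b zero    = solveℚ 3
  (λ x y z → (x :+ y) :* z :+ con 0ℚ := (x :* z :+ con 0ℚ) :+ (y :* z :+ con 0ℚ))
  refl (a 0) (b 0) (c 0)
∗-distribʳ c a b (suc n) = trans
  (cong ((a 0 ℚ.+ b 0) ℚ.* c (suc n) ℚ.+_) (∗-distribʳ c (a ∘ suc) (b ∘ suc) n))
  (solveℚ 5 (λ x y z u v → (x :+ y) :* z :+ (u :+ v) := (x :* z :+ u) :+ (y :* z :+ v))
    refl (a 0) (b 0) (c (suc n)) _ _)

∗-scaleˡ : ∀ x a b n → ((λ i → x ℚ.* a i) ∗ b) n ≡ x ℚ.* (a ∗ b) n
∗-scaleˡ x a b zero    = solveℚ 3
  (λ x y z → x :* y :* z :+ con 0ℚ := x :* (y :* z :+ con 0ℚ)) refl x (a 0) (b 0)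
∗-scaleˡ x a b (suc n) = trans
  (cong (x ℚ.* a 0 ℚ.* b (suc n) ℚ.+_) (∗-scaleˡ x (a ∘ suc) b n))
  (solveℚ 4 (λ x y z u → x :* y :* z :+ x :* u := x :* (y :* z :+ u))
    refl x (a 0) (b (suc n)) _)

-- `dot` unfolds from the first digit of `a`. Splitting off the term with `b 0` instead is what lets
-- `∗-comm` exchange the two recursions.
∗-suc : ∀ a b n → (a ∗ b) (suc n) ≡ (a ∗ (b ∘ suc)) n ℚ.+ a (suc n) ℚ.* b 0
∗-suc a b zero    = solveℚ 4
  (λ x y z u → x :* y :+ (z :* u :+ con 0ℚ) := (x :* y :+ con 0ℚ) :+ z :* u)
  refl (a 0) (b 1) (a 1) (b 0)
∗-suc a b (suc n) = trans
  (cong (a 0 ℚ.* b (suc (suc n)) ℚ.+_) (∗-suc (a ∘ suc) b n))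
  (sym (ℚ.+-assoc (a 0 ℚ.* b (suc (suc n))) _ _))

∗-comm : ∀ a b → a ∗ b ≗ b ∗ a
∗-comm a b zero    = cong (ℚ._+ 0ℚ) (ℚ.*-comm (a 0) (b 0))
∗-comm a b (suc n) = begin
  a 0 ℚ.* b (suc n) ℚ.+ ((a ∘ suc) ∗ b) n ≡⟨ ℚ.+-comm (a 0 ℚ.* b (suc n)) _ ⟩
  ((a ∘ suc) ∗ b) n ℚ.+ a 0 ℚ.* b (suc n) ≡⟨ cong₂ ℚ._+_ (∗-comm (a ∘ suc) b n) (ℚ.*-comm (a 0) (b (suc n))) ⟩
  (b ∗ (a ∘ suc)) n ℚ.+ b (suc n) ℚ.* a 0 ≡⟨ ∗-suc b a n ⟨
  (b ∗ a) (suc n)                         ∎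
  where open ≡-Reasoning

∗-assoc : ∀ a b c → (a ∗ b) ∗ c ≗ a ∗ (b ∗ c)
∗-assoc a b c zero    = solveℚ 3
  (λ x y z → (x :* y :+ con 0ℚ) :* z :+ con 0ℚ := x :* (y :* z :+ con 0ℚ) :+ con 0ℚ)
  refl (a 0) (b 0) (c 0)
∗-assoc a b c (suc n) = begin
  (a ∗ b) 0 ℚ.* c (suc n) ℚ.+ (((a ∗ b) ∘ suc) ∗ c) n
    ≡⟨ cong ((a ∗ b) 0 ℚ.* c (suc n) ℚ.+_)
         (∗-distribʳ c (λ i → a 0 ℚ.* b (suc i)) ((a ∘ suc) ∗ b) n) ⟩
  (a ∗ b) 0 ℚ.* c (suc n) ℚ.+ (((λ i → a 0 ℚ.* b (suc i)) ∗ c) n ℚ.+ (((a ∘ suc) ∗ b) ∗ c) n)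
    ≡⟨ cong₂ (λ x y → (a ∗ b) 0 ℚ.* c (suc n) ℚ.+ (x ℚ.+ y))
         (∗-scaleˡ (a 0) (b ∘ suc) c n) (∗-assoc (a ∘ suc) b c n) ⟩
  (a ∗ b) 0 ℚ.* c (suc n) ℚ.+ (a 0 ℚ.* ((b ∘ suc) ∗ c) n ℚ.+ ((a ∘ suc) ∗ (b ∗ c)) n)
    ≡⟨ solveℚ 5 (λ x y z u v → (x :* y :+ con 0ℚ) :* z :+ (x :* u :+ v)
                            := x :* (y :* z :+ u) :+ v)
         refl (a 0) (b 0) (c (suc n)) _ _ ⟩
  a 0 ℚ.* (b ∗ c) (suc n) ℚ.+ ((a ∘ suc) ∗ (b ∗ c)) n ∎
  where open ≡-Reasoning

-- Serves products of polynomials: counted down from T^s and T^t, the digits past s and past t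
-- belong to negative powers.
∗-support : ∀ s t a b → (∀ i → s ℕ.< i → a i ≡ 0ℚ) → (∀ i → t ℕ.< i → b i ≡ 0ℚ) →
            ∀ n → s ℕ.+ t ℕ.< n → (a ∗ b) n ≡ 0ℚ
∗-support zero    t a b a≡0 b≡0 (suc n) t<n
  rewrite b≡0 (suc n) t<n =
  cong₂ ℚ._+_ (ℚ.*-zeroʳ (a 0)) (∗-zeroˡ b (λ i → a≡0 (suc i) (ℕ.s≤s ℕ.z≤n)) n)
∗-support (suc s) t a b a≡0 b≡0 (suc n) (ℕ.s≤s s+t<n)
  rewrite b≡0 (suc n) (ℕ.≤-trans (ℕ.s≤s (ℕ.m≤n+m t s)) (ℕ.m≤n⇒m≤1+n s+t<n)) =
  cong₂ ℚ._+_ (ℚ.*-zeroʳ (a 0))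
    (∗-support s t (a ∘ suc) b (λ i s<i → a≡0 (suc i) (ℕ.s≤s s<i)) b≡0 n s+t<n)

-- `invDigits` carries all earlier digits along, while the series reads only the heads. Identifying
-- the two turns the recursion for the inverse into a Cauchy product.
invDigits-tail : ∀ u a n → downFrom (Vec.head ∘ invDigits u a) n ≡ invDigits u a n
invDigits-tail u a zero    = refl
invDigits-tail u a (suc n) =
  cong (ℚ.- (u ℚ.* dot (a ∘ suc) (invDigits u a n)) ∷_) (invDigits-tail u a n)

∗-inverse : ∀ u a → a 0 ℚ.* u ≡ 1ℚ → a ∗ (Vec.head ∘ invDigits u a) ≗ unit
∗-inverse u a a₀u≡1 zero    = trans (ℚ.+-identityʳ _) a₀u≡1
∗-inverse u a a₀u≡1 (suc n) rewrite invDigits-tail u a n = begin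
  a 0 ℚ.* (ℚ.- (u ℚ.* x)) ℚ.+ x     ≡⟨ solveℚ 3 (λ a u x → a :* (:- (u :* x)) :+ x := (:- (a :* u)) :* x :+ x) refl (a 0) u x ⟩
  (ℚ.- (a 0 ℚ.* u)) ℚ.* x ℚ.+ x     ≡⟨ cong (λ y → (ℚ.- y) ℚ.* x ℚ.+ x) a₀u≡1 ⟩
  (ℚ.- 1ℚ) ℚ.* x ℚ.+ x              ≡⟨ solveℚ 1 (λ x → (:- con 1ℚ) :* x :+ x := con 0ℚ) refl x ⟩
  0ℚ                                ∎
  where
  open ≡-Reasoning
  x = dot (a ∘ suc) (invDigits u a n)

-- The ring of Laurent series

digitAt-cong : ∀ {a b} → a ≗ b → ∀ i → digitAt a i ≡ digitAt b i
digitAt-cong a≗b (+ n)    = a≗b n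
digitAt-cong a≗b -[1+ n ] = refl

digitAt-shift : ∀ a b → a 0 ≡ 0ℚ → a ∘ suc ≗ b → ∀ i → digitAt a (1ℤ ℤ.+ i) ≡ digitAt b i
digitAt-shift a b a₀≡0 a≗b (+ n)          = a≗b n
digitAt-shift a b a₀≡0 a≗b -[1+ zero ]    = a₀≡0
digitAt-shift a b a₀≡0 a≗b -[1+ (suc n) ] = refl

digitAt-+ : ∀ a b i → digitAt (λ n → a n ℚ.+ b n) i ≡ digitAt a i ℚ.+ digitAt b i
digitAt-+ a b (+ n)    = refl
digitAt-+ a b -[1+ n ] = refl

t-[t-i]≡i : ∀ t i → t ℤ.- (t ℤ.- i) ≡ i
t-[t-i]≡i = solve-∀

i≤j⇒i+n≡j : ∀ {i j} → i ℤ.≤ j → ∃ λ n → i ℤ.+ + n ≡ j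
i≤j⇒i+n≡j {i} {j} i≤j =
  ∣ j ℤ.- i ∣ , trans (cong (λ d → i ℤ.+ d) (ℤ.0≤i⇒+∣i∣≡i (ℤ.i≤j⇒0≤j-i i≤j))) (cancel i j)
  where
  cancel : ∀ i j → i ℤ.+ (j ℤ.- i) ≡ j
  cancel = solve-∀

infix 4 _≋_ _≼_

-- Records rather than synonyms, so that the series can be inferred from a proof.
record _≋_ (f g : Laurent) : Set where
  constructor mk≋
  field at : f ≈ g
open _≋_ public

record _≼_ (f : Laurent) (m : ℤ) : Set where
  constructor mk≼
  field above : Deg≤ f m
open _≼_ public

≼-top : ∀ f → f ≼ top f
≼-top f .above = coeff-above-top f

≼-resp : ∀ {f g m} → f ≋ g → f ≼ m → g ≼ m
≼-resp f≋g f≼m .above j m<j = trans (sym (at f≋g j)) (above f≼m j m<j)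

≼-mono : ∀ {f m n} → m ℤ.≤ n → f ≼ m → f ≼ n
≼-mono m≤n f≼m .above j n<j = above f≼m j (ℤ.≤-<-trans m≤n n<j)

-- The digits of f counted down from T^s instead of T^(top f).
digitsFrom : Laurent → ℤ → Digits
digitsFrom f s n = coeff f (s ℤ.- + n)

digitsFrom-top : ∀ f → digitsFrom f (top f) ≗ digits f
digitsFrom-top f n = cong (digitAt (digits f)) (t-[t-i]≡i (top f) (+ n))

digitsFrom-suc : ∀ f s n → digitsFrom f (1ℤ ℤ.+ s) (suc n) ≡ digitsFrom f s n
digitsFrom-suc f s n = cong (coeff f) (eq s (+ n))
  where
  eq : ∀ s i → 1ℤ ℤ.+ s ℤ.- (1ℤ ℤ.+ i) ≡ s ℤ.- i
  eq = solve-∀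

-- The coefficient of T^j in f ⊗ g, read from expansions starting at T^s and T^t.
productAt : Laurent → Laurent → ℤ → ℤ → ℤ → ℚ
productAt f g s t j = digitAt (digitsFrom f s ∗ digitsFrom g t) (s ℤ.+ t ℤ.- j)

productAt-comm : ∀ f g s t j → productAt f g s t j ≡ productAt g f t s j
productAt-comm f g s t j = trans
  (digitAt-cong (∗-comm (digitsFrom f s) (digitsFrom g t)) (s ℤ.+ t ℤ.- j))
  (cong (λ i → digitAt (digitsFrom g t ∗ digitsFrom f s) (i ℤ.- j)) (ℤ.+-comm s t))

-- Starting one power higher prepends a zero digit to `f`, hence to the Cauchy product, and moves
-- the index of T^j by one; the two shifts cancel.
productAt-raise : ∀ {f s} → f ≼ s → ∀ k g t j →
                  productAt f g (+ k ℤ.+ s) t j ≡ productAt f g s t j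
productAt-raise {f} {s} f≼s zero g t j =
  cong (λ s′ → productAt f g s′ t j) (ℤ.+-identityˡ s)
productAt-raise {f} {s} f≼s (suc k) g t j = begin
  productAt f g (+ suc k ℤ.+ s) t j   ≡⟨ cong (λ s″ → productAt f g s″ t j) (ℤ.+-assoc 1ℤ (+ k) s) ⟩
  productAt f g (1ℤ ℤ.+ s′) t j       ≡⟨ cong (digitAt _) (eq s′ t j) ⟩
  digitAt _ (1ℤ ℤ.+ (s′ ℤ.+ t ℤ.- j)) ≡⟨ digitAt-shift _ _ starts-with-0 shifted (s′ ℤ.+ t ℤ.- j) ⟩
  productAt f g s′ t j                ≡⟨ productAt-raise f≼s k g t j ⟩
  productAt f g s t j                 ∎
  where
  open ≡-Reasoning
  s′ = + k ℤ.+ s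
  b = digitsFrom g t
  eq : ∀ s t j → 1ℤ ℤ.+ s ℤ.+ t ℤ.- j ≡ 1ℤ ℤ.+ (s ℤ.+ t ℤ.- j)
  eq = solve-∀
  zero-digit : digitsFrom f (1ℤ ℤ.+ s′) 0 ≡ 0ℚ
  zero-digit = above f≼s _ (subst (s ℤ.<_) (sym (ℤ.+-identityʳ (1ℤ ℤ.+ s′)))
    (ℤ.suc[i]≤j⇒i<j (ℤ.suc-mono {x = s} (ℤ.i≤j+i s (+ k)))))
  starts-with-0 : (digitsFrom f (1ℤ ℤ.+ s′) ∗ b) 0 ≡ 0ℚ
  starts-with-0 rewrite zero-digit = trans (ℚ.+-identityʳ _) (ℚ.*-zeroˡ (b 0))
  shifted : (digitsFrom f (1ℤ ℤ.+ s′) ∗ b) ∘ suc ≗ digitsFrom f s′ ∗ b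
  shifted n rewrite zero-digit = begin
    0ℚ ℚ.* b (suc n) ℚ.+ ((digitsFrom f (1ℤ ℤ.+ s′) ∘ suc) ∗ b) n
      ≡⟨ cong₂ ℚ._+_ (ℚ.*-zeroˡ (b (suc n))) (∗-cong (digitsFrom-suc f s′) (λ _ → refl) n) ⟩
    0ℚ ℚ.+ (digitsFrom f s′ ∗ b) n
      ≡⟨ ℚ.+-identityˡ _ ⟩
    (digitsFrom f s′ ∗ b) n ∎

productAt-mono : ∀ {f s s′} → f ≼ s → s ℤ.≤ s′ → ∀ g t j →
                 productAt f g s t j ≡ productAt f g s′ t j
productAt-mono {f} {s} f≼s s≤s′ g t j =
  let k , s+k≡s′ = i≤j⇒i+n≡j s≤s′ in
  trans (sym (productAt-raise f≼s k g t j))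
        (cong (λ s″ → productAt f g s″ t j) (trans (ℤ.+-comm (+ k) s) s+k≡s′))

productAt-indep : ∀ {f s s′} → f ≼ s → f ≼ s′ → ∀ g t j →
                  productAt f g s t j ≡ productAt f g s′ t j
productAt-indep {f} {s} {s′} f≼s f≼s′ g t j with ℤ.≤-total s s′
... | inj₁ s≤s′ = productAt-mono f≼s s≤s′ g t j
... | inj₂ s′≤s = sym (productAt-mono f≼s′ s′≤s g t j)

-- Frees products from the accidental `top` of a representation: congruence, the ring laws and
-- degree bounds follow by choosing convenient s and t. The start of the second factor is changed by
-- commuting twice.
coeff-⊗ : ∀ f g {s t} → f ≼ s → g ≼ t → ∀ j → coeff (f ⊗ g) j ≡ productAt f g s t j
coeff-⊗ f g {s} {t} f≼s g≼t j = begin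
  coeff (f ⊗ g) j                   ≡⟨ digitAt-cong (λ n → sym (∗-cong (digitsFrom-top f) (digitsFrom-top g) n)) (top f ℤ.+ top g ℤ.- j) ⟩
  productAt f g (top f) (top g) j   ≡⟨ productAt-indep (≼-top f) f≼s g (top g) j ⟩
  productAt f g s (top g) j         ≡⟨ productAt-comm f g s (top g) j ⟩
  productAt g f (top g) s j         ≡⟨ productAt-indep (≼-top g) g≼t f s j ⟩
  productAt g f t s j               ≡⟨ productAt-comm g f t s j ⟩
  productAt f g s t j               ∎
  where open ≡-Reasoning

digitsFrom-⊗ : ∀ f g {s t} → f ≼ s → g ≼ t →
               digitsFrom (f ⊗ g) (s ℤ.+ t) ≗ digitsFrom f s ∗ digitsFrom g t
digitsFrom-⊗ f g {s} {t} f≼s g≼t n =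
  trans (coeff-⊗ f g f≼s g≼t _) (cong (digitAt _) (t-[t-i]≡i (s ℤ.+ t) (+ n)))

0# 1# : Laurent
0# = laurent 0ℤ λ _ → 0ℚ
1# = laurent 0ℤ unit

digitAt-0 : ∀ i → digitAt (λ _ → 0ℚ) i ≡ 0ℚ
digitAt-0 (+ n)    = refl
digitAt-0 -[1+ n ] = refl

coeff-0# : ∀ j → coeff 0# j ≡ 0ℚ
coeff-0# j = digitAt-0 (0ℤ ℤ.- j)

coeff-neg : ∀ f j → coeff (neg f) j ≡ ℚ.- coeff f j
coeff-neg f j = digitAt-neg (top f ℤ.- j)
  where
  digitAt-neg : ∀ i → digitAt (λ n → ℚ.- digits f n) i ≡ ℚ.- digitAt (digits f) i
  digitAt-neg (+ n)    = refl
  digitAt-neg -[1+ n ] = refl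

≋-refl : ∀ {f} → f ≋ f
≋-refl .at j = refl

≋-sym : ∀ {f g} → f ≋ g → g ≋ f
≋-sym f≋g .at j = sym (at f≋g j)

≋-trans : ∀ {f g h} → f ≋ g → g ≋ h → f ≋ h
≋-trans f≋g g≋h .at j = trans (at f≋g j) (at g≋h j)

⊕-cong : ∀ {f f′ g g′} → f ≋ f′ → g ≋ g′ → f ⊕ g ≋ f′ ⊕ g′
⊕-cong {f} {f′} {g} {g′} f≋f′ g≋g′ .at j =
  trans (coeff-⊕ f g j) (trans (cong₂ ℚ._+_ (at f≋f′ j) (at g≋g′ j)) (sym (coeff-⊕ f′ g′ j)))

⊕-assoc : ∀ f g h → (f ⊕ g) ⊕ h ≋ f ⊕ (g ⊕ h)
⊕-assoc f g h .at j = begin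
  coeff ((f ⊕ g) ⊕ h) j                       ≡⟨ coeff-⊕ (f ⊕ g) h j ⟩
  coeff (f ⊕ g) j ℚ.+ coeff h j               ≡⟨ cong (ℚ._+ coeff h j) (coeff-⊕ f g j) ⟩
  (coeff f j ℚ.+ coeff g j) ℚ.+ coeff h j     ≡⟨ ℚ.+-assoc (coeff f j) _ _ ⟩
  coeff f j ℚ.+ (coeff g j ℚ.+ coeff h j)     ≡⟨ cong (coeff f j ℚ.+_) (coeff-⊕ g h j) ⟨
  coeff f j ℚ.+ coeff (g ⊕ h) j               ≡⟨ coeff-⊕ f (g ⊕ h) j ⟨
  coeff (f ⊕ (g ⊕ h)) j                       ∎
  where open ≡-Reasoning

⊕-comm : ∀ f g → f ⊕ g ≋ g ⊕ f
⊕-comm f g .at j =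
  trans (coeff-⊕ f g j) (trans (ℚ.+-comm (coeff f j) _) (sym (coeff-⊕ g f j)))

⊕-identityˡ : ∀ f → 0# ⊕ f ≋ f
⊕-identityˡ f .at j = trans (coeff-⊕ 0# f j)
  (trans (cong (ℚ._+ coeff f j) (coeff-0# j)) (ℚ.+-identityˡ (coeff f j)))

⊕-inverseˡ : ∀ f → neg f ⊕ f ≋ 0#
⊕-inverseˡ f .at j = begin
  coeff (neg f ⊕ f) j             ≡⟨ coeff-⊕ (neg f) f j ⟩
  coeff (neg f) j ℚ.+ coeff f j   ≡⟨ cong (ℚ._+ coeff f j) (coeff-neg f j) ⟩
  ℚ.- coeff f j ℚ.+ coeff f j     ≡⟨ ℚ.+-inverseˡ (coeff f j) ⟩
  0ℚ                              ≡⟨ coeff-0# j ⟨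
  coeff 0# j                      ∎
  where open ≡-Reasoning

neg-cong : ∀ {f g} → f ≋ g → neg f ≋ neg g
neg-cong {f} {g} f≋g .at j =
  trans (coeff-neg f j) (trans (cong ℚ.-_ (at f≋g j)) (sym (coeff-neg g j)))

⊗-cong : ∀ {f f′ g g′} → f ≋ f′ → g ≋ g′ → f ⊗ g ≋ f′ ⊗ g′
⊗-cong {f} {f′} {g} {g′} f≋f′ g≋g′ .at j = begin
  coeff (f ⊗ g) j                     ≡⟨ coeff-⊗ f g (≼-top f) (≼-top g) j ⟩
  productAt f g (top f) (top g) j     ≡⟨ digitAt-cong (∗-cong (λ n → at f≋f′ _) (λ n → at g≋g′ _)) (top f ℤ.+ top g ℤ.- j) ⟩
  productAt f′ g′ (top f) (top g) j   ≡⟨ coeff-⊗ f′ g′ (≼-resp f≋f′ (≼-top f)) (≼-resp g≋g′ (≼-top g)) j ⟨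
  coeff (f′ ⊗ g′) j                   ∎
  where open ≡-Reasoning

⊗-comm : ∀ f g → f ⊗ g ≋ g ⊗ f
⊗-comm f g .at j = begin
  coeff (f ⊗ g) j                   ≡⟨ coeff-⊗ f g (≼-top f) (≼-top g) j ⟩
  productAt f g (top f) (top g) j   ≡⟨ productAt-comm f g (top f) (top g) j ⟩
  productAt g f (top g) (top f) j   ≡⟨ coeff-⊗ g f (≼-top g) (≼-top f) j ⟨
  coeff (g ⊗ f) j                   ∎
  where open ≡-Reasoning

≼-⊗ : ∀ {f g m n} → f ≼ m → g ≼ n → f ⊗ g ≼ m ℤ.+ n
≼-⊗ {f} {g} {m} {n} f≼m g≼n .above j m+n<j =
  trans (coeff-⊗ f g f≼m g≼n j) (coeff-above-top (laurent (m ℤ.+ n) _) j m+n<j)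

⊗-assoc : ∀ f g h → (f ⊗ g) ⊗ h ≋ f ⊗ (g ⊗ h)
⊗-assoc f g h .at j = begin
  coeff ((f ⊗ g) ⊗ h) j
    ≡⟨ coeff-⊗ (f ⊗ g) h (≼-⊗ (≼-top f) (≼-top g)) (≼-top h) j ⟩
  digitAt (digitsFrom (f ⊗ g) (s ℤ.+ t) ∗ c) (s ℤ.+ t ℤ.+ u ℤ.- j)
    ≡⟨ digitAt-cong (λ n → trans (∗-cong (digitsFrom-⊗ f g (≼-top f) (≼-top g)) (λ _ → refl) n)
         (trans (∗-assoc a b c n) (sym (∗-cong {a = a} (λ _ → refl) (digitsFrom-⊗ g h (≼-top g) (≼-top h)) n)))) (s ℤ.+ t ℤ.+ u ℤ.- j) ⟩
  digitAt (a ∗ digitsFrom (g ⊗ h) (t ℤ.+ u)) (s ℤ.+ t ℤ.+ u ℤ.- j)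
    ≡⟨ cong (λ i → digitAt (a ∗ digitsFrom (g ⊗ h) (t ℤ.+ u)) (i ℤ.- j)) (ℤ.+-assoc s t u) ⟩
  digitAt (a ∗ digitsFrom (g ⊗ h) (t ℤ.+ u)) (s ℤ.+ (t ℤ.+ u) ℤ.- j)
    ≡⟨ coeff-⊗ f (g ⊗ h) (≼-top f) (≼-⊗ (≼-top g) (≼-top h)) j ⟨
  coeff (f ⊗ (g ⊗ h)) j ∎
  where
  open ≡-Reasoning
  s = top f
  t = top g
  u = top h
  a = digitsFrom f s
  b = digitsFrom g t
  c = digitsFrom h u

⊗-identityˡ : ∀ f → 1# ⊗ f ≋ f
⊗-identityˡ f .at j = begin
  coeff (1# ⊗ f) j                  ≡⟨ digitAt-cong (∗-identityˡ (digits f)) (0ℤ ℤ.+ top f ℤ.- j) ⟩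
  digitAt (digits f) (0ℤ ℤ.+ top f ℤ.- j) ≡⟨ cong (λ i → digitAt (digits f) (i ℤ.- j)) (ℤ.+-identityˡ (top f)) ⟩
  coeff f j                         ∎
  where open ≡-Reasoning

⊗-distribʳ : ∀ h f g → (f ⊕ g) ⊗ h ≋ f ⊗ h ⊕ g ⊗ h
⊗-distribʳ h f g .at j = begin
  coeff ((f ⊕ g) ⊗ h) j
    ≡⟨ coeff-⊗ (f ⊕ g) h (≼-top (f ⊕ g)) (≼-top h) j ⟩
  digitAt (digitsFrom (f ⊕ g) s ∗ c) i
    ≡⟨ digitAt-cong (λ n → trans (∗-cong {a′ = λ i → digitsFrom f s i ℚ.+ digitsFrom g s i} (λ i → coeff-⊕ f g _) (λ _ → refl) n)
         (∗-distribʳ c (digitsFrom f s) (digitsFrom g s) n)) i ⟩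
  digitAt (λ n → (digitsFrom f s ∗ c) n ℚ.+ (digitsFrom g s ∗ c) n) i
    ≡⟨ digitAt-+ (digitsFrom f s ∗ c) (digitsFrom g s ∗ c) i ⟩
  productAt f h s (top h) j ℚ.+ productAt g h s (top h) j
    ≡⟨ cong₂ ℚ._+_ (coeff-⊗ f h (≼-mono (ℤ.i≤i⊔j (top f) (top g)) (≼-top f)) (≼-top h) j)
                   (coeff-⊗ g h (≼-mono (ℤ.i≤j⊔i (top f) (top g)) (≼-top g)) (≼-top h) j) ⟨
  coeff (f ⊗ h) j ℚ.+ coeff (g ⊗ h) j
    ≡⟨ coeff-⊕ (f ⊗ h) (g ⊗ h) j ⟨
  coeff (f ⊗ h ⊕ g ⊗ h) j ∎
  where
  open ≡-Reasoning
  s = top f ℤ.⊔ top g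
  i = s ℤ.+ top h ℤ.- j
  c = digitsFrom h (top h)

laurentRing : CommutativeRing 0ℓ 0ℓ
laurentRing = record
  { Carrier = Laurent ; _≈_ = _≋_ ; _+_ = _⊕_ ; _*_ = _⊗_ ; -_ = neg ; 0# = 0# ; 1# = 1#
  ; isCommutativeRing = record
    { isRing = record
      { +-isAbelianGroup = record
        { isGroup = record
          { isMonoid = record
            { isSemigroup = record
              { isMagma = record
                { isEquivalence = record { refl = ≋-refl ; sym = ≋-sym ; trans = ≋-trans }
                ; ∙-cong = ⊕-cong }
              ; assoc = ⊕-assoc }
            ; identity = ⊕-identityˡ , λ f → ≋-trans (⊕-comm f 0#) (⊕-identityˡ f) }
          ; inverse = ⊕-inverseˡ , λ f → ≋-trans (⊕-comm f (neg f)) (⊕-inverseˡ f)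
          ; ⁻¹-cong = neg-cong }
        ; comm = ⊕-comm }
      ; *-cong = ⊗-cong
      ; *-assoc = ⊗-assoc
      ; *-identity = ⊗-identityˡ , λ f → ≋-trans (⊗-comm f 1#) (⊗-identityˡ f)
      ; distrib = (λ f g h → ≋-trans (⊗-comm f (g ⊕ h)) (≋-trans (⊗-distribʳ f g h)
                                (⊕-cong (⊗-comm g f) (⊗-comm h f))))
                , ⊗-distribʳ }
    ; *-comm = ⊗-comm } }

module R = CommutativeRing laurentRing
module ≋-Reasoning = SetoidReasoning R.setoid

⊗-congˡ : ∀ f {g h} → g ≋ h → f ⊗ g ≋ f ⊗ h
⊗-congˡ f = ⊗-cong (≋-refl {f})

⊗-congʳ : ∀ f {g h} → g ≋ h → g ⊗ f ≋ h ⊗ f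
⊗-congʳ f g≋h = ⊗-cong g≋h (≋-refl {f})

⊖-cong : ∀ {f f′ g g′} → f ≋ f′ → g ≋ g′ → f ⊖ g ≋ f′ ⊖ g′
⊖-cong f≋f′ g≋g′ = ⊕-cong f≋f′ (neg-cong g≋g′)

⊗-distribˡ-⊖ : ∀ f g h → f ⊗ (g ⊖ h) ≋ f ⊗ g ⊖ f ⊗ h
⊗-distribˡ-⊖ = RingProperties.x[y-z]≈xy-xz R.ring

⊗-distribʳ-⊖ : ∀ h f g → (f ⊖ g) ⊗ h ≋ f ⊗ h ⊖ g ⊗ h
⊗-distribʳ-⊖ = RingProperties.[y-z]x≈yx-zx R.ring

-- Degree bounds

coeff-⊖ : ∀ f g j → coeff (f ⊖ g) j ≡ coeff f j ℚ.- coeff g j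
coeff-⊖ f g j = trans (coeff-⊕ f (neg g) j) (cong (coeff f j ℚ.+_) (coeff-neg g j))

-- Reading closeness as agreement of all coefficients above T^m makes symmetry and the ultrametric
-- inequality immediate.
⊖-≼⇒≡ : ∀ {f g m} → f ⊖ g ≼ m → ∀ {j} → m ℤ.< j → coeff f j ≡ coeff g j
⊖-≼⇒≡ {f} {g} f-g≼m {j} m<j = begin
  coeff f j                               ≡⟨ ℚ.+-identityʳ (coeff f j) ⟨
  coeff f j ℚ.+ 0ℚ                        ≡⟨ cong (coeff f j ℚ.+_) (ℚ.+-inverseˡ (coeff g j)) ⟨
  coeff f j ℚ.+ (ℚ.- coeff g j ℚ.+ coeff g j) ≡⟨ ℚ.+-assoc (coeff f j) _ _ ⟨
  coeff f j ℚ.- coeff g j ℚ.+ coeff g j   ≡⟨ cong (ℚ._+ coeff g j) (coeff-⊖ f g j) ⟨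
  coeff (f ⊖ g) j ℚ.+ coeff g j           ≡⟨ cong (ℚ._+ coeff g j) (above f-g≼m j m<j) ⟩
  0ℚ ℚ.+ coeff g j                        ≡⟨ ℚ.+-identityˡ (coeff g j) ⟩
  coeff g j                               ∎
  where open ≡-Reasoning

≡⇒⊖-≼ : ∀ {f g m} → (∀ j → m ℤ.< j → coeff f j ≡ coeff g j) → f ⊖ g ≼ m
≡⇒⊖-≼ {f} {g} f≡g .above j m<j = trans (coeff-⊖ f g j)
  (trans (cong (ℚ._- coeff g j) (f≡g j m<j)) (ℚ.+-inverseʳ (coeff g j)))

⊖-≼-sym : ∀ {f g m} → f ⊖ g ≼ m → g ⊖ f ≼ m
⊖-≼-sym f-g≼m = ≡⇒⊖-≼ λ j m<j → sym (⊖-≼⇒≡ f-g≼m m<j)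

⊖-≼-trans : ∀ {f g h m} → f ⊖ g ≼ m → g ⊖ h ≼ m → f ⊖ h ≼ m
⊖-≼-trans f-g≼m g-h≼m = ≡⇒⊖-≼ λ j m<j → trans (⊖-≼⇒≡ f-g≼m m<j) (⊖-≼⇒≡ g-h≼m m<j)

⊖-≼⇒≋ : ∀ {f g} → (∀ m → f ⊖ g ≼ m) → f ≋ g
⊖-≼⇒≋ f-g≼m .at j = ⊖-≼⇒≡ (f-g≼m (ℤ.pred j)) (ℤ.i≤pred[j]⇒i<j ℤ.≤-refl)

≋⇒⊖-≼ : ∀ {f g} → f ≋ g → ∀ {m} → f ⊖ g ≼ m
≋⇒⊖-≼ f≋g = ≡⇒⊖-≼ λ j _ → at f≋g j

≼-⊕ : ∀ {f g m} → f ≼ m → g ≼ m → f ⊕ g ≼ m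
≼-⊕ {f} {g} f≼m g≼m .above j m<j =
  trans (coeff-⊕ f g j) (cong₂ ℚ._+_ (above f≼m j m<j) (above g≼m j m<j))

≼-neg : ∀ {f m} → f ≼ m → neg f ≼ m
≼-neg {f} f≼m .above j m<j = trans (coeff-neg f j) (cong ℚ.-_ (above f≼m j m<j))

≼-⊖ : ∀ {f g m} → f ≼ m → g ≼ m → f ⊖ g ≼ m
≼-⊖ f≼m g≼m = ≼-⊕ f≼m (≼-neg g≼m)

≼-close : ∀ {f g m} → f ⊖ g ≼ m → f ≼ m → g ≼ m
≼-close f-g≼m f≼m .above j m<j = trans (sym (⊖-≼⇒≡ f-g≼m m<j)) (above f≼m j m<j)

record Degree (f : Laurent) (d : ℤ) : Set where
  constructor mkDegree
  field hasDegree : HasDegree f d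
open Degree public

degree-≼ : ∀ {f d} → Degree f d → f ≼ d
degree-≼ (mkDegree (_ , f≤d)) = mk≼ f≤d

degree-≤ : ∀ {f d m} → Degree f d → f ≼ m → d ℤ.≤ m
degree-≤ {f} f-d f≼m = Deg≤⇒≤ f (hasDegree f-d) (above f≼m)

-- A perturbation below the leading term leaves it intact. The degrees of `C ⊕ β`, of the
-- transported denominators and of λᵢ are all found this way.
degree-close : ∀ {f g m d} → f ⊖ g ≼ m → m ℤ.< d → Degree f d → Degree g d
degree-close f-g≼m m<d (mkDegree (lead , f≤d)) = mkDegree
  ( (λ g≡0 → lead (trans (⊖-≼⇒≡ f-g≼m m<d) g≡0))
  , λ j d<j → trans (sym (⊖-≼⇒≡ f-g≼m (ℤ.<-trans m<d d<j))) (f≤d j d<j))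

degree-resp : ∀ {f g d} → f ≋ g → Degree f d → Degree g d
degree-resp {d = d} f≋g = degree-close {m = ℤ.pred d} (≋⇒⊖-≼ f≋g) (ℤ.i≤pred[j]⇒i<j ℤ.≤-refl)

*-≢0 : ∀ {p q} → p ≢ 0ℚ → q ≢ 0ℚ → p ℚ.* q ≢ 0ℚ
*-≢0 {p} {q} p≢0 q≢0 pq≡0 = q≢0 (begin
  q                       ≡⟨ ℚ.*-identityˡ q ⟨
  1ℚ ℚ.* q                ≡⟨ cong (ℚ._* q) (ℚ.*-inverseˡ p) ⟨
  (ℚ.1/ p) ℚ.* p ℚ.* q    ≡⟨ ℚ.*-assoc (ℚ.1/ p) p q ⟩
  (ℚ.1/ p) ℚ.* (p ℚ.* q)  ≡⟨ cong ((ℚ.1/ p) ℚ.*_) pq≡0 ⟩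
  (ℚ.1/ p) ℚ.* 0ℚ         ≡⟨ ℚ.*-zeroʳ (ℚ.1/ p) ⟩
  0ℚ                      ∎)
  where
  open ≡-Reasoning
  instance _ = ℚ.≢-nonZero p≢0

degree-⊗ : ∀ {f g d e} → Degree f d → Degree g e → Degree (f ⊗ g) (d ℤ.+ e)
degree-⊗ {f} {g} {d} {e} f-d g-e = mkDegree
  ( (λ fg≡0 → *-≢0 (proj₁ (hasDegree f-d)) (proj₁ (hasDegree g-e)) (trans (sym lead) fg≡0))
  , above (≼-⊗ (degree-≼ f-d) (degree-≼ g-e)))
  where
  open ≡-Reasoning
  lead : coeff (f ⊗ g) (d ℤ.+ e) ≡ coeff f d ℚ.* coeff g e
  lead = begin
    coeff (f ⊗ g) (d ℤ.+ e)              ≡⟨ cong (coeff (f ⊗ g)) (ℤ.+-identityʳ (d ℤ.+ e)) ⟨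
    digitsFrom (f ⊗ g) (d ℤ.+ e) 0       ≡⟨ digitsFrom-⊗ f g (degree-≼ f-d) (degree-≼ g-e) 0 ⟩
    coeff f (d ℤ.+ 0ℤ) ℚ.* coeff g (e ℤ.+ 0ℤ) ℚ.+ 0ℚ ≡⟨ ℚ.+-identityʳ _ ⟩
    coeff f (d ℤ.+ 0ℤ) ℚ.* coeff g (e ℤ.+ 0ℤ)
      ≡⟨ cong₂ (λ x y → coeff f x ℚ.* coeff g y) (ℤ.+-identityʳ d) (ℤ.+-identityʳ e) ⟩
    coeff f d ℚ.* coeff g e              ∎

⊗-inverse : ∀ f f≢0 → f ⊗ inv f f≢0 ≋ 1#
⊗-inverse f f≢0@(d , lead , f≤d) .at j = begin
  coeff (f ⊗ g) j                    ≡⟨ coeff-⊗ f g (mk≼ {f} f≤d) (≼-top g) j ⟩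
  digitAt (digitsFrom f d ∗ digitsFrom g (ℤ.- d)) (d ℤ.- d ℤ.- j)
    ≡⟨ digitAt-cong (λ n → trans (∗-cong {a = digitsFrom f d} (λ _ → refl) (digitsFrom-top g) n)
         (∗-inverse u (digitsFrom f d) lead*u≡1 n)) (d ℤ.- d ℤ.- j) ⟩
  digitAt unit (d ℤ.- d ℤ.- j)       ≡⟨ cong (λ i → digitAt unit (i ℤ.- j)) (ℤ.+-inverseʳ d) ⟩
  coeff 1# j                         ∎
  where
  open ≡-Reasoning
  instance _ = ℚ.≢-nonZero lead
  g = inv f f≢0
  u = ℚ.1/ coeff f d
  lead*u≡1 : digitsFrom f d 0 ℚ.* u ≡ 1ℚ
  lead*u≡1 = trans (cong (λ i → coeff f i ℚ.* u) (ℤ.+-identityʳ d)) (ℚ.*-inverseʳ (coeff f d))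

degree-inv : ∀ f f≢0 → Degree (inv f f≢0) (ℤ.- proj₁ f≢0)
degree-inv f f≢0@(d , lead , f≤d) = mkDegree (lead′ , above (≼-top (inv f f≢0)))
  where
  instance _ = ℚ.≢-nonZero lead
  coeff≡1/lead : coeff (inv f f≢0) (ℤ.- d) ≡ ℚ.1/ coeff f d
  coeff≡1/lead = cong (digitAt (digits (inv f f≢0))) (ℤ.+-inverseʳ (ℤ.- d))
  lead′ : coeff (inv f f≢0) (ℤ.- d) ≢ 0ℚ
  lead′ eq = ℚ.1≢0 (begin
    1ℚ                           ≡⟨ ℚ.*-inverseʳ (coeff f d) ⟨
    coeff f d ℚ.* (ℚ.1/ coeff f d) ≡⟨ cong (coeff f d ℚ.*_) (trans (sym coeff≡1/lead) eq) ⟩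
    coeff f d ℚ.* 0ℚ             ≡⟨ ℚ.*-zeroʳ (coeff f d) ⟩
    0ℚ                           ∎)
    where open ≡-Reasoning

inverse-unique : ∀ {f g h} → f ⊗ g ≋ 1# → f ⊗ h ≋ 1# → g ≋ h
inverse-unique {f} {g} {h} fg≋1 fh≋1 = begin
  g             ≈⟨ R.*-identityʳ g ⟨
  g ⊗ 1#        ≈⟨ ⊗-congˡ g fh≋1 ⟨
  g ⊗ (f ⊗ h)   ≈⟨ R.*-assoc g f h ⟨
  (g ⊗ f) ⊗ h   ≈⟨ ⊗-congʳ h (≋-trans (R.*-comm g f) fg≋1) ⟩
  1# ⊗ h        ≈⟨ R.*-identityˡ h ⟩
  h             ∎
  where open ≋-Reasoning

-- Polynomials and their quotients

-- Polynomials are recognised by their coefficients, which spares arithmetic on lists;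
-- `polynomialPart` leads back to `Poly`.
record IsPolynomial (f : Laurent) : Set where
  field below-0 : ∀ {j} → j ℤ.< 0ℤ → coeff f j ≡ 0ℚ
open IsPolynomial public

polynomial-0 : IsPolynomial 0#
polynomial-0 .below-0 {j} _ = coeff-0# j

polynomial-1 : IsPolynomial 1#
polynomial-1 .below-0 { -[1+ n ] } _ = refl
polynomial-1 .below-0 { + n } (ℤ.+<+ ())

polynomial-⊕ : ∀ {f g} → IsPolynomial f → IsPolynomial g → IsPolynomial (f ⊕ g)
polynomial-⊕ {f} {g} f-poly g-poly .below-0 {j} j<0 =
  trans (coeff-⊕ f g j) (cong₂ ℚ._+_ (below-0 f-poly j<0) (below-0 g-poly j<0))

polynomial-⊖ : ∀ {f g} → IsPolynomial f → IsPolynomial g → IsPolynomial (f ⊖ g)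
polynomial-⊖ {f} {g} f-poly g-poly .below-0 {j} j<0 =
  trans (coeff-⊖ f g j) (cong₂ ℚ._-_ (below-0 f-poly j<0) (below-0 g-poly j<0))

i≤∣i∣ : ∀ i → i ℤ.≤ + ∣ i ∣
i≤∣i∣ (+ n)    = ℤ.≤-refl
i≤∣i∣ -[1+ n ] = ℤ.-≤+

i<j⇒i-j<0 : ∀ {i j} → i ℤ.< j → i ℤ.- j ℤ.< 0ℤ
i<j⇒i-j<0 {i} {j} i<j = subst (i ℤ.- j ℤ.<_) (ℤ.+-inverseʳ j) (ℤ.+-monoˡ-< (ℤ.- j) i<j)

polynomial-⊗ : ∀ {f g} → IsPolynomial f → IsPolynomial g → IsPolynomial (f ⊗ g)
polynomial-⊗ {f} {g} f-poly g-poly .below-0 {j} j<0 = begin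
  coeff (f ⊗ g) j                        ≡⟨ cong (coeff (f ⊗ g)) j≡m-n ⟩
  digitsFrom (f ⊗ g) (+ s ℤ.+ + t) n     ≡⟨ digitsFrom-⊗ f g (raise f) (raise g) n ⟩
  (digitsFrom f (+ s) ∗ digitsFrom g (+ t)) n ≡⟨ ∗-support s t _ _ (support f-poly s) (support g-poly t) n s+t<n ⟩
  0ℚ                                     ∎
  where
  open ≡-Reasoning
  -- Natural starting exponents, at least the tops, so that every digit past position s or t belongs
  -- to a negative power.
  s = ∣ top f ∣
  t = ∣ top g ∣
  raise : ∀ f → f ≼ + ∣ top f ∣
  raise f = ≼-mono (i≤∣i∣ (top f)) (≼-top f)
  support : ∀ {f} → IsPolynomial f → ∀ s i → s ℕ.< i → digitsFrom f (+ s) i ≡ 0ℚ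
  support f-poly s i s<i = below-0 f-poly (i<j⇒i-j<0 (ℤ.+<+ s<i))
  gap : ∃ λ n → j ℤ.+ + n ≡ + (s ℕ.+ t)
  gap = i≤j⇒i+n≡j (ℤ.≤-trans (ℤ.<⇒≤ j<0) (ℤ.+≤+ ℕ.z≤n))
  n = proj₁ gap
  s+t<n : s ℕ.+ t ℕ.< n
  s+t<n = ℤ.drop‿+<+ (subst₂ ℤ._<_ (proj₂ gap) (ℤ.+-identityˡ (+ n)) (ℤ.+-monoˡ-< (+ n) j<0))
  j≡m-n : j ≡ + s ℤ.+ + t ℤ.- + n
  j≡m-n = trans (cancel j (+ n)) (cong (λ i → i ℤ.- + n) (proj₂ gap))
    where
    cancel : ∀ j n → j ≡ j ℤ.+ n ℤ.- n
    cancel = solve-∀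

polynomial-degree : ∀ {f d} → IsPolynomial f → Degree f d → 0ℤ ℤ.≤ d
polynomial-degree f-poly (mkDegree (lead , _)) = ℤ.≮⇒≥ λ d<0 → lead (below-0 f-poly d<0)

coeff-tabulate : ∀ (h : ℤ → ℚ) t → (∀ j → t ℤ.< j → h j ≡ 0ℚ) →
                 ∀ j → coeff (laurent t λ n → h (t ℤ.- + n)) j ≡ h j
coeff-tabulate h t h≡0 j with t ℤ.- j in eq
... | + n      = cong h (trans (cong (λ i → t ℤ.- i) (sym eq)) (t-[t-i]≡i t j))
... | -[1+ n ] = sym (h≡0 j (ℤ.≰⇒> λ j≤t → contradiction (subst (0ℤ ℤ.≤_) eq (ℤ.i≤j⇒0≤j-i j≤t)) λ ()))

polyCoeff-above : ∀ p n → length p ℕ.≤ n → polyCoeff p n ≡ 0ℚ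
polyCoeff-above []      n       _           = refl
polyCoeff-above (a ∷ p) (suc n) (ℕ.s≤s p≤n) = polyCoeff-above p n p≤n

coeff-ι : ∀ p j → coeff (ι p) j ≡ digitAt (polyCoeff p) j
coeff-ι p = coeff-tabulate (digitAt (polyCoeff p)) (+ length p) λ where
  (+ n) (ℤ.+<+ p<n) → polyCoeff-above p n (ℕ.<⇒≤ p<n)

polynomial-ι : ∀ p → IsPolynomial (ι p)
polynomial-ι p .below-0 { -[1+ n ] } _ = coeff-ι p -[1+ n ]
polynomial-ι p .below-0 { + n } (ℤ.+<+ ())

polyCoeff-applyUpTo : ∀ a m n → n ℕ.< m → polyCoeff (applyUpTo a m) n ≡ a n
polyCoeff-applyUpTo a (suc m) zero    _           = refl
polyCoeff-applyUpTo a (suc m) (suc n) (ℕ.s≤s n<m) = polyCoeff-applyUpTo (a ∘ suc) m n n<m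

polynomialPart : Laurent → Poly
polynomialPart f = applyUpTo (coeff f ∘ +_) (suc ∣ top f ∣)

coeff-polynomialPart : ∀ f n → coeff (ι (polynomialPart f)) (+ n) ≡ coeff f (+ n)
coeff-polynomialPart f n with n ℕ.<? suc ∣ top f ∣
... | yes n<m = trans (coeff-ι (polynomialPart f) (+ n)) (polyCoeff-applyUpTo (coeff f ∘ +_) (suc ∣ top f ∣) n n<m)
... | no  n≮m = trans (coeff-ι (polynomialPart f) (+ n)) (trans
  (polyCoeff-above (polynomialPart f) n
    (subst (ℕ._≤ n) (sym (List.length-applyUpTo (coeff f ∘ +_) (suc ∣ top f ∣))) (ℕ.≮⇒≥ n≮m)))
  (sym (above (≼-top f) (+ n) (ℤ.≤-<-trans (i≤∣i∣ (top f)) (ℤ.+<+ (ℕ.≮⇒≥ n≮m))))))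

⊖-polynomialPart : ∀ f → f ⊖ ι (polynomialPart f) ≼ -1ℤ
⊖-polynomialPart f = ≡⇒⊖-≼ λ where
  (+ n) _ → sym (coeff-polynomialPart f n)
  -[1+ n ] (ℤ.-<- ())

polynomialPart-≋ : ∀ {f} → IsPolynomial f → ι (polynomialPart f) ≋ f
polynomialPart-≋ {f} f-poly .at (+ n)    = coeff-polynomialPart f n
polynomialPart-≋ {f} f-poly .at -[1+ n ] =
  trans (below-0 (polynomial-ι (polynomialPart f)) ℤ.-<+) (sym (below-0 f-poly ℤ.-<+))

-- The given degree e becomes `degDen` by definition, so later degree equations hold by `refl`.
ratio : ∀ {P Q e} → IsPolynomial P → IsPolynomial Q → Degree Q e → Fraction
ratio {P} {Q} {e} _ Q-poly Q-e = fraction (polynomialPart P) (polynomialPart Q)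
  (e , hasDegree (degree-resp (≋-sym (polynomialPart-≋ Q-poly)) Q-e))

⊗-value : ∀ r → ι (den r) ⊗ value r ≋ ι (num r)
⊗-value r = begin
  Q ⊗ (P ⊗ 1/Q)  ≈⟨ R.*-assoc Q P 1/Q ⟨
  (Q ⊗ P) ⊗ 1/Q  ≈⟨ ⊗-congʳ 1/Q (R.*-comm Q P) ⟩
  (P ⊗ Q) ⊗ 1/Q  ≈⟨ R.*-assoc P Q 1/Q ⟩
  P ⊗ (Q ⊗ 1/Q)  ≈⟨ ⊗-congˡ P (⊗-inverse Q (den≢0 r)) ⟩
  P ⊗ 1#         ≈⟨ R.*-identityʳ P ⟩
  P              ∎
  where
  open ≋-Reasoning
  P = ι (num r)
  Q = ι (den r)
  1/Q = inv Q (den≢0 r)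

-- Multiplying by q turns quality k into a bound on the linear form qα - p, on which the maps
-- between fractions act linearly.
approximates⇒ : ∀ {α k} r → Approximates α k r →
                ι (den r) ⊗ α ⊖ ι (num r) ≼ ℤ.- degDen r ℤ.- k
approximates⇒ {α} {k} r α≈r = subst (_ ≼_) (eq (degDen r) k) (≼-resp
  (≋-trans (⊗-distribˡ-⊖ Q α (value r)) (⊖-cong ≋-refl (⊗-value r)))
  (≼-⊗ (degree-≼ {Q} (mkDegree (proj₂ (den≢0 r)))) (mk≼ {α ⊖ value r} α≈r)))
  where
  Q = ι (den r)
  eq : ∀ e k → e ℤ.+ (ℤ.- (+ 2 ℤ.* e) ℤ.- k) ≡ ℤ.- e ℤ.- k
  eq = solve-∀

⇒approximates : ∀ {α k} r → ι (den r) ⊗ α ⊖ ι (num r) ≼ ℤ.- degDen r ℤ.- k →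
                Approximates α k r
⇒approximates {α} {k} r close = above (subst (_ ≼_) (eq (degDen r) k) (≼-resp (begin
  1/Q ⊗ (Q ⊗ α ⊖ P)            ≈⟨ ⊗-congˡ 1/Q (⊖-cong ≋-refl (⊗-value r)) ⟨
  1/Q ⊗ (Q ⊗ α ⊖ Q ⊗ value r)  ≈⟨ ⊗-congˡ 1/Q (⊗-distribˡ-⊖ Q α (value r)) ⟨
  1/Q ⊗ (Q ⊗ (α ⊖ value r))    ≈⟨ R.*-assoc 1/Q Q _ ⟨
  (1/Q ⊗ Q) ⊗ (α ⊖ value r)    ≈⟨ ⊗-congʳ (α ⊖ value r) (≋-trans (R.*-comm 1/Q Q) (⊗-inverse Q (den≢0 r))) ⟩
  1# ⊗ (α ⊖ value r)           ≈⟨ R.*-identityˡ _ ⟩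
  α ⊖ value r                  ∎)
  (≼-⊗ (≼-top 1/Q) close)))
  where
  open ≋-Reasoning
  P = ι (num r)
  Q = ι (den r)
  1/Q = inv Q (den≢0 r)
  eq : ∀ e k → ℤ.- e ℤ.+ (ℤ.- e ℤ.- k) ≡ ℤ.- (+ 2 ℤ.* e) ℤ.- k
  eq = solve-∀

ratio-approximates : ∀ {α k P Q e} (P-poly : IsPolynomial P) (Q-poly : IsPolynomial Q)
                     (Q-e : Degree Q e) → Q ⊗ α ⊖ P ≼ ℤ.- e ℤ.- k →
                     Approximates α k (ratio P-poly Q-poly Q-e)
ratio-approximates {α} P-poly Q-poly Q-e close = ⇒approximates {α} (ratio P-poly Q-poly Q-e)
  (≼-resp (⊖-cong (⊗-congʳ α (≋-sym (polynomialPart-≋ Q-poly)))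
                  (≋-sym (polynomialPart-≋ P-poly))) close)

-- Transport of approximations

-- Leaves a linear inequality to the ring solver: it holds once its two sides differ by as much as
-- those of a known one.
≤-by : ∀ {x y a b} → x ℤ.≤ y → b ℤ.- a ≡ y ℤ.- x → a ℤ.≤ b
≤-by x≤y eq = ℤ.0≤i-j⇒j≤i (subst (0ℤ ℤ.≤_) (sym eq) (ℤ.i≤j⇒0≤j-i x≤y))

<-by : ∀ {x y a b} → x ℤ.≤ y → b ℤ.- (1ℤ ℤ.+ a) ≡ y ℤ.- x → a ℤ.< b
<-by x≤y eq = ℤ.suc[i]≤j⇒i<j (≤-by x≤y eq)

-∣i∣≤i : ∀ i → ℤ.- (+ ∣ i ∣) ℤ.≤ i
-∣i∣≤i i = subst₂ ℤ._≤_ (cong (ℤ.-_ ∘ +_) (ℤ.∣-i∣≡∣i∣ i)) (ℤ.neg-involutive i)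
             (ℤ.neg-mono-≤ (i≤∣i∣ (ℤ.- i)))

⊕-close : ∀ {f g m} → g ≼ m → f ⊖ (f ⊕ g) ≼ m
⊕-close {f} {g} g≼m = ≡⇒⊖-≼ λ j m<j → sym (trans (coeff-⊕ f g j)
  (trans (cong (coeff f j ℚ.+_) (above g≼m j m<j)) (ℚ.+-identityʳ (coeff f j))))

⊖-⊕-cancelˡ : ∀ f g h → (f ⊕ g) ⊖ (f ⊕ h) ≋ g ⊖ h
⊖-⊕-cancelˡ f g h .at j
  rewrite coeff-⊖ (f ⊕ g) (f ⊕ h) j | coeff-⊕ f g j | coeff-⊕ f h j | coeff-⊖ g h j =
  solveℚ 3 (λ x y z → (x :+ y) :+ (:- (x :+ z)) := y :+ (:- z)) refl
    (coeff f j) (coeff g j) (coeff h j)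

⊕-⊖-rotate : ∀ f g h → (f ⊕ g) ⊖ h ≋ g ⊖ (h ⊖ f)
⊕-⊖-rotate f g h .at j
  rewrite coeff-⊖ (f ⊕ g) h j | coeff-⊕ f g j | coeff-⊖ g (h ⊖ f) j | coeff-⊖ h f j =
  solveℚ 3 (λ x y z → (x :+ y) :+ (:- z) := y :+ (:- (z :+ (:- x)))) refl
    (coeff f j) (coeff g j) (coeff h j)

⊖-⊖-swap : ∀ f g h → (f ⊖ g) ⊖ h ≋ f ⊖ (h ⊕ g)
⊖-⊖-swap f g h .at j
  rewrite coeff-⊖ (f ⊖ g) h j | coeff-⊖ f g j | coeff-⊖ f (h ⊕ g) j | coeff-⊕ h g j =
  solveℚ 3 (λ x y z → (x :+ (:- y)) :+ (:- z) := x :+ (:- (z :+ y))) refl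
    (coeff f j) (coeff g j) (coeff h j)

⊕-⊖-cancel : ∀ f g → g ⊕ (f ⊖ g) ≋ f
⊕-⊖-cancel f g .at j rewrite coeff-⊕ g (f ⊖ g) j | coeff-⊖ f g j =
  solveℚ 2 (λ x y → y :+ (x :+ (:- y)) := x) refl (coeff f j) (coeff g j)

-- One continued fraction step α = 1/(C + β). The product form suits both a given α, with β the
-- fractional part of 1/α, and limits of convergents, for which only the product is obtained.
module Reciprocal {α β C k} (α[C+β]≋1 : α ⊗ (C ⊕ β) ≋ 1#)
       (C-poly : IsPolynomial C) (C-k : Degree C k) (1≤k : 1ℤ ℤ.≤ k) (β≼-1 : β ≼ -1ℤ) where

  private
    [C+β]f : ∀ f → (C ⊕ β) ⊗ f ≋ C ⊗ f ⊕ f ⊗ β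
    [C+β]f f = ≋-trans (⊗-distribʳ f C β) (⊕-cong (≋-refl {C ⊗ f}) (⊗-comm β f))

    α[C+β]f≋f : ∀ f → α ⊗ ((C ⊕ β) ⊗ f) ≋ f
    α[C+β]f≋f f = ≋-trans (≋-sym (⊗-assoc α (C ⊕ β) f))
      (≋-trans (⊗-congʳ f α[C+β]≋1) (⊗-identityˡ f))

    degree-C+β : Degree (C ⊕ β) k
    degree-C+β = degree-close (⊕-close β≼-1) (ℤ.<-≤-trans ℤ.-<+ 1≤k) C-k

  degree-reciprocal : Degree α (ℤ.- k)
  degree-reciprocal = degree-resp
    (inverse-unique {C ⊕ β} (⊗-inverse (C ⊕ β) (k , hasDegree degree-C+β))
                            (≋-trans (⊗-comm (C ⊕ β) α) α[C+β]≋1))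
    (degree-inv (C ⊕ β) (k , hasDegree degree-C+β))

  -- p/q ↦ q/(cq + p).
  lift-approximation : ∀ r → Approximates β 1ℤ r → ∃ λ r′ →
    degDen r′ ≡ k ℤ.+ degDen r × (∀ m → Approximates β m r → Approximates α m r′)
  lift-approximation r β≈r = ratio Q-poly Q′-poly Q′-deg , refl , λ m β≈r →
    ratio-approximates {α} Q-poly Q′-poly Q′-deg
      (subst (Q′ ⊗ α ⊖ Q ≼_) (eq k e m)
        (≼-resp (≋-sym error) (≼-⊗ (degree-≼ degree-reciprocal)
                                   (⊖-≼-sym (approximates⇒ {β} r β≈r)))))
    where
    open ≋-Reasoning
    P = ι (num r)
    Q = ι (den r)
    e = degDen r
    Q′ = C ⊗ Q ⊕ P
    Q-poly = polynomial-ι (den r)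
    Q-e : Degree Q e
    Q-e = mkDegree (proj₂ (den≢0 r))
    0≤e : 0ℤ ℤ.≤ e
    0≤e = polynomial-degree Q-poly Q-e
    Q′-poly : IsPolynomial Q′
    Q′-poly = polynomial-⊕ (polynomial-⊗ C-poly Q-poly) (polynomial-ι (num r))
    -- Quality 1 enters here: the error has degree at most -e - 1 ≤ e - 1, as does qβ, so deg p <
    -- deg q and p cannot cancel the leading term of cq.
    P-small : P ≼ e ℤ.- 1ℤ
    P-small = ≼-close
      (≼-mono (≤-by (ℤ.+-mono-≤ 0≤e 0≤e) (eq₁ e)) (approximates⇒ {β} r β≈r))
      (≼-⊗ (degree-≼ Q-e) β≼-1)
      where
      eq₁ : ∀ e → e ℤ.- 1ℤ ℤ.- (ℤ.- e ℤ.- 1ℤ) ≡ e ℤ.+ e ℤ.- 0ℤ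
      eq₁ = solve-∀
    Q′-deg : Degree Q′ (k ℤ.+ e)
    Q′-deg = degree-close (⊕-close P-small) (<-by (ℤ.≤-trans (ℤ.+≤+ ℕ.z≤n) 1≤k) (eq₂ k e))
                          (degree-⊗ C-k Q-e)
      where
      eq₂ : ∀ k e → k ℤ.+ e ℤ.- (1ℤ ℤ.+ (e ℤ.- 1ℤ)) ≡ k ℤ.- 0ℤ
      eq₂ = solve-∀
    error : Q′ ⊗ α ⊖ Q ≋ α ⊗ (P ⊖ Q ⊗ β)
    error = begin
      Q′ ⊗ α ⊖ Q                              ≈⟨ ⊖-cong (⊗-comm Q′ α) (≋-sym (α[C+β]f≋f Q)) ⟩
      α ⊗ Q′ ⊖ α ⊗ ((C ⊕ β) ⊗ Q)              ≈⟨ ⊖-cong (≋-refl {α ⊗ Q′}) (⊗-congˡ α ([C+β]f Q)) ⟩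
      α ⊗ Q′ ⊖ α ⊗ (C ⊗ Q ⊕ Q ⊗ β)            ≈⟨ ⊗-distribˡ-⊖ α Q′ (C ⊗ Q ⊕ Q ⊗ β) ⟨
      α ⊗ (Q′ ⊖ (C ⊗ Q ⊕ Q ⊗ β))              ≈⟨ ⊗-congˡ α (⊖-⊕-cancelˡ (C ⊗ Q) P (Q ⊗ β)) ⟩
      α ⊗ (P ⊖ Q ⊗ β)                         ∎
    eq : ∀ k e m → ℤ.- k ℤ.+ (ℤ.- e ℤ.- m) ≡ ℤ.- (k ℤ.+ e) ℤ.- m
    eq = solve-∀

  -- p/q ↦ (q - cp)/p, the inverse of the map above.
  lower-approximation : ∀ m → k ℤ.< m → ∀ r → Approximates α m r → ∃ λ r′ →
    degDen r′ ≡ degDen r ℤ.- k × Approximates β m r′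
  lower-approximation m k<m r α≈r = ratio P′-poly P-poly P-deg , refl ,
    ratio-approximates {β} P′-poly P-poly P-deg
      (subst (P ⊗ β ⊖ P′ ≼_) (eq k e m)
        (≼-resp error (≼-⊗ (degree-≼ degree-C+β) (⊖-≼-sym close))))
    where
    open ≋-Reasoning
    P = ι (num r)
    Q = ι (den r)
    e = degDen r
    P′ = Q ⊖ C ⊗ P
    P-poly = polynomial-ι (num r)
    Q-poly = polynomial-ι (den r)
    P′-poly : IsPolynomial P′
    P′-poly = polynomial-⊖ Q-poly (polynomial-⊗ C-poly P-poly)
    Q-e : Degree Q e
    Q-e = mkDegree (proj₂ (den≢0 r))
    0≤e : 0ℤ ℤ.≤ e
    0≤e = polynomial-degree Q-poly Q-e
    close : Q ⊗ α ⊖ P ≼ ℤ.- e ℤ.- m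
    close = approximates⇒ {α} r α≈r
    -- qα has degree e - k, and m > k with e ≥ 0 puts the error -e - m below it. Hence p is nonzero
    -- and can serve as a denominator.
    P-deg : Degree P (e ℤ.- k)
    P-deg = degree-close close
      (<-by (ℤ.+-mono-≤ (ℤ.+-mono-≤ 0≤e 0≤e) (ℤ.i<j⇒suc[i]≤j k<m)) (eq₁ k e m))
      (degree-⊗ Q-e degree-reciprocal)
      where
      eq₁ : ∀ k e m → e ℤ.- k ℤ.- (1ℤ ℤ.+ (ℤ.- e ℤ.- m)) ≡ e ℤ.+ e ℤ.+ m ℤ.- (0ℤ ℤ.+ 0ℤ ℤ.+ (1ℤ ℤ.+ k))
      eq₁ = solve-∀
    error : (C ⊕ β) ⊗ (P ⊖ Q ⊗ α) ≋ P ⊗ β ⊖ P′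
    error = begin
      (C ⊕ β) ⊗ (P ⊖ Q ⊗ α)                 ≈⟨ ⊗-distribˡ-⊖ (C ⊕ β) P (Q ⊗ α) ⟩
      (C ⊕ β) ⊗ P ⊖ (C ⊕ β) ⊗ (Q ⊗ α)       ≈⟨ ⊖-cong ([C+β]f P) (≋-trans (≋-sym (⊗-assoc (C ⊕ β) Q α))
                                                 (≋-trans (⊗-comm _ α) (α[C+β]f≋f Q))) ⟩
      (C ⊗ P ⊕ P ⊗ β) ⊖ Q                   ≈⟨ ⊕-⊖-rotate (C ⊗ P) (P ⊗ β) Q ⟩
      P ⊗ β ⊖ P′                            ∎
    eq : ∀ k e m → k ℤ.+ (ℤ.- e ℤ.- m) ≡ ℤ.- (e ℤ.- k) ℤ.- m
    eq = solve-∀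

-- p/q ↦ (p + qC)/q, which reduces Dirichlet's theorem to series of negative degree.
translate-approximation : ∀ {α C} → IsPolynomial C → ∀ r → ∃ λ r′ →
  degDen r′ ≡ degDen r × (∀ m → Approximates (α ⊖ C) m r → Approximates α m r′)
translate-approximation {α} {C} C-poly r = ratio P′-poly Q-poly Q-e , refl , λ m α-C≈r →
  ratio-approximates {α} P′-poly Q-poly Q-e (≼-resp error (approximates⇒ {α ⊖ C} r α-C≈r))
  where
  P = ι (num r)
  Q = ι (den r)
  Q-poly = polynomial-ι (den r)
  P′-poly : IsPolynomial (P ⊕ Q ⊗ C)
  P′-poly = polynomial-⊕ (polynomial-ι (num r)) (polynomial-⊗ Q-poly C-poly)
  Q-e : Degree Q (degDen r)
  Q-e = mkDegree (proj₂ (den≢0 r))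
  error : Q ⊗ (α ⊖ C) ⊖ P ≋ Q ⊗ α ⊖ (P ⊕ Q ⊗ C)
  error = ≋-trans (⊖-cong (⊗-distribˡ-⊖ Q α C) (≋-refl {P})) (⊖-⊖-swap (Q ⊗ α) (Q ⊗ C) P)

-- Dirichlet's theorem and infinitude of approximations

degree-1 : Degree 1# 0ℤ
degree-1 = mkDegree ((λ ()) , coeff-above-top 1#)

0/1 : Fraction
0/1 = ratio polynomial-0 polynomial-1 degree-1

-- The base of both upward inductions: since deg 1 = 0, the fraction 0/1 has quality -deg α, which
-- is at least 1 for a fractional part and equals deg c₀ for [0, c₀, ...].
zero-approximates : ∀ α m → α ≼ ℤ.- m → Approximates α m 0/1
zero-approximates α m α≼-m =
  ratio-approximates {α} {m} polynomial-0 polynomial-1 degree-1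
    (subst (1# ⊗ α ⊖ 0# ≼_) (sym (ℤ.+-identityˡ (ℤ.- m)))
      (≼-⊖ (≼-resp (≋-sym (⊗-identityˡ α)) α≼-m) (mk≼ λ j _ → coeff-0# j)))

rational⇒approximates : ∀ {α} r → α ≈ value r → ∀ m → Approximates α m r
rational⇒approximates {α} r α≈r m = above (≋⇒⊖-≼ {α} {value r} (mk≋ α≈r))

approximates⇒rational : ∀ {α} r → (∀ m → Approximates α m r) → α ≈ value r
approximates⇒rational {α} r α≈r = at (⊖-≼⇒≋ {α} {value r} λ m →
  subst (α ⊖ value r ≼_) (t-[t-i]≡i (ℤ.- (+ 2 ℤ.* degDen r)) m) (mk≼ (α≈r (ℤ.- (+ 2 ℤ.* degDen r) ℤ.- m))))

-- If no coefficient leads, then they vanish one after another from `top f` down, and each exponent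
-- is reached after finitely many steps.
¬¬-degree : ∀ {f} → ¬ (f ≋ 0#) → ¬ ¬ (∃ λ d → Degree f d)
¬¬-degree {f} f≢0 no-degree = f≢0 (mk≋ λ j → trans (vanishes j) (sym (coeff-0# j)))
  where
  descend : ∀ n → f ≼ top f ℤ.- + n
  descend zero    = subst (f ≼_) (sym (ℤ.+-identityʳ (top f))) (≼-top f)
  descend (suc n) .above j m<j with ℤ.<-cmp (top f ℤ.- + n) j
  ... | tri< t-n<j _ _ = above (descend n) j t-n<j
  ... | tri> _ _ j<t-n = contradiction j<t-n
    (ℤ.≤⇒≯ (≤-by (ℤ.i<j⇒suc[i]≤j m<j) (eq (top f) (+ n) j)))
    where
    eq : ∀ t n j → j ℤ.- (t ℤ.- n) ≡ j ℤ.- (1ℤ ℤ.+ (t ℤ.- (1ℤ ℤ.+ n)))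
    eq = solve-∀
  ... | tri≈ _ refl _ with coeff f j ℚ.≟ 0ℚ
  ...   | yes c≡0 = c≡0
  ...   | no  c≢0 = contradiction (j , mkDegree (c≢0 , above (descend n))) no-degree

  vanishes : ∀ j → coeff f j ≡ 0ℚ
  vanishes j = above (descend (suc ∣ top f ℤ.- j ∣)) j
    (<-by (i≤∣i∣ (top f ℤ.- j)) (eq (top f) j (+ ∣ top f ℤ.- j ∣)))
    where
    eq : ∀ t j n → j ℤ.- (1ℤ ℤ.+ (t ℤ.- (1ℤ ℤ.+ n))) ≡ n ℤ.- (t ℤ.- j)
    eq = solve-∀

-- Unbounded denominators are what induction along the expansion yields; the double negation costs
-- nothing, since the goal `InfinitelyMany` is a negation.
HasLargeApproximations : Laurent → ℤ → Set
HasLargeApproximations α k = ∀ n → ¬ ¬ (∃ λ r → + n ℤ.≤ degDen r × Approximates α k r)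

-- By irrationality some T^(-M) separates α from every value of a finite list, while an
-- approximation with a large enough denominator comes closer than that.
infinitely-many : ∀ α {k} → ¬ Rational α → HasLargeApproximations α k →
                  InfinitelyMany (Approximates α k)
infinitely-many α {k} α-irr large (rs , cover) = separated rs λ (M , apart) →
  -- deg q ≥ M + |k| ensures 2 deg q + k ≥ M, also for negative k.
  large (M ℕ.+ ∣ k ∣) λ (r , M+∣k∣≤e , α≈r) →
  All¬⇒¬Any (All.map (λ {s} far r≈s → far (≼-resp (⊖-cong (≋-refl {α}) (mk≋ r≈s)) (near M r M+∣k∣≤e α≈r))) apart)
            (cover r α≈r)
  where
  near : ∀ M r → + (M ℕ.+ ∣ k ∣) ℤ.≤ degDen r → Approximates α k r →
         α ⊖ value r ≼ ℤ.- (+ M)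
  near M r M+∣k∣≤e α≈r = ≼-mono
    (≤-by (ℤ.+-mono-≤ (ℤ.+-mono-≤ M+∣k∣≤e (ℤ.≤-trans (ℤ.+≤+ ℕ.z≤n) M+∣k∣≤e)) (-∣i∣≤i k))
      (eq (+ M) (+ ∣ k ∣) (degDen r) k))
    (mk≼ {α ⊖ value r} α≈r)
    where
    eq : ∀ M ∣k∣ e k → ℤ.- M ℤ.- (ℤ.- (+ 2 ℤ.* e) ℤ.- k) ≡
         e ℤ.+ e ℤ.+ k ℤ.- (M ℤ.+ ∣k∣ ℤ.+ 0ℤ ℤ.+ (ℤ.- ∣k∣))
    eq = solve-∀

  apart-from : ∀ s → ¬ ¬ (∃ λ M → ¬ (α ⊖ value s ≼ ℤ.- (+ M)))
  apart-from s not-apart = α-irr (s , at (⊖-≼⇒≋ {α} {value s} λ m → mk≼ λ j _ → vanishes j))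
    where
    vanishes : ∀ j → coeff (α ⊖ value s) j ≡ 0ℚ
    vanishes j with coeff (α ⊖ value s) j ℚ.≟ 0ℚ
    ... | yes c≡0 = c≡0
    -- A nonzero coefficient of T^j refutes every degree bound below j, such as -(|j| + 1).
    ... | no  c≢0 = contradiction
      (suc ∣ j ∣ , λ close → c≢0 (above close j (<-by (-∣i∣≤i j) (eq j (+ ∣ j ∣))))) not-apart
      where
      eq : ∀ j n → j ℤ.- (1ℤ ℤ.+ (ℤ.- (1ℤ ℤ.+ n))) ≡ j ℤ.- (ℤ.- n)
      eq = solve-∀

  separated : ∀ rs → ¬ ¬ (∃ λ M → All (λ s → ¬ (α ⊖ value s ≼ ℤ.- (+ M))) rs)
  separated []       none = none (0 , [])
  separated (s ∷ rs) none = apart-from s λ (M , far) → separated rs λ (N , apart) →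
    none (M ℕ.+ N , (far ∘ ≼-mono (ℤ.neg-mono-≤ (ℤ.+≤+ (ℕ.m≤m+n M N))))
                  ∷ All.map (_∘ ≼-mono (ℤ.neg-mono-≤ (ℤ.+≤+ (ℕ.m≤n+m N M)))) apart)

-- Induction on the wanted degree of q: each expansion step contributes k ≥ 1 to it. A step inverts
-- α and so needs its degree, whence the double negation.
dirichlet-fractional : ∀ n α → α ≼ -1ℤ → ¬ Rational α →
                       ¬ ¬ (∃ λ r → + n ℤ.≤ degDen r × Approximates α 1ℤ r)
dirichlet-fractional zero    α α≼-1 α-irr none =
  none (0/1 , ℤ.≤-refl , zero-approximates α 1ℤ α≼-1)
dirichlet-fractional (suc n) α α≼-1 α-irr none = ¬¬-degree α≢0 λ (d , α-d) → step d α-d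
  where
  α≢0 : ¬ (α ≋ 0#)
  α≢0 α≋0 = α-irr (0/1 , approximates⇒rational {α} 0/1 λ m →
    zero-approximates α m (mk≼ λ j _ → trans (at α≋0 j) (coeff-0# j)))
  step : ∀ d → Degree α d → _
  step d α-d = dirichlet-fractional n β β≼-1 β-irr λ (r , n≤e , β≈r) →
    let r′ , e′≡k+e , lift = Reciprocal.lift-approximation {α} α[C+β]≋1 C-poly C-k 1≤k β≼-1 r β≈r in
    none (r′ , subst (_ ℤ.≤_) (sym e′≡k+e) (ℤ.+-mono-≤ 1≤k n≤e) , lift 1ℤ β≈r)
    where
    α≢0′ : Nonzero α
    α≢0′ = d , hasDegree α-d
    1≤k : 1ℤ ℤ.≤ ℤ.- d
    1≤k = ℤ.neg-mono-≤ (degree-≤ α-d α≼-1)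
    C = ι (polynomialPart (inv α α≢0′))
    β = inv α α≢0′ ⊖ C
    C-poly = polynomial-ι (polynomialPart (inv α α≢0′))
    β≼-1 : β ≼ -1ℤ
    β≼-1 = ⊖-polynomialPart (inv α α≢0′)
    C-k : Degree C (ℤ.- d)
    C-k = degree-close β≼-1 (ℤ.<-≤-trans ℤ.-<+ 1≤k) (degree-inv α α≢0′)
    α[C+β]≋1 : α ⊗ (C ⊕ β) ≋ 1#
    α[C+β]≋1 = ≋-trans (⊗-congˡ α (⊕-⊖-cancel (inv α α≢0′) C)) (⊗-inverse α α≢0′)
    β-irr : ¬ Rational β
    -- The lifted fraction does not depend on the quality m, so it approximates α with every quality
    -- and is equal to it.
    β-irr (r , β≈r) =
      let r′ , _ , lift = Reciprocal.lift-approximation {α} α[C+β]≋1 C-poly C-k 1≤k β≼-1 r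
                            (rational⇒approximates {β} r β≈r 1ℤ) in
      α-irr (r′ , approximates⇒rational {α} r′ λ m → lift m (rational⇒approximates {β} r β≈r m))

dirichlet : ∀ {α} → ¬ Rational α → HasLargeApproximations α 1ℤ
dirichlet {α} α-irr n none = dirichlet-fractional n β (⊖-polynomialPart α) β-irr λ (r , n≤e , β≈r) →
  let r′ , e′≡e , translate = translate-approximation {α} C-poly r in
  none (r′ , subst (_ ℤ.≤_) (sym e′≡e) n≤e , translate 1ℤ β≈r)
  where
  C-poly = polynomial-ι (polynomialPart α)
  β = α ⊖ ι (polynomialPart α)
  β-irr : ¬ Rational β
  β-irr (r , β≈r) =
    let r′ , _ , translate = translate-approximation {α} C-poly r in
    α-irr (r′ , approximates⇒rational {α} r′ λ m → translate m (rational⇒approximates {β} r β≈r m))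

-- Continued fractions

inv⁺-≼ : ∀ f f⁺ → inv⁺ f f⁺ ≼ -1ℤ
inv⁺-≼ f f⁺@(d , _ , 1≤d) = ≼-mono (ℤ.neg-mono-≤ 1≤d) (≼-top (inv⁺ f f⁺))

-- 1/f - 1/g = (g - f)/(fg) gains deg f + deg g ≥ 2 degrees; one is enough for precision to grow
-- with depth.
inv⁺-contracts : ∀ f f⁺ g g⁺ {m} → f ⊖ g ≼ m → inv⁺ f f⁺ ⊖ inv⁺ g g⁺ ≼ -1ℤ ℤ.+ m
inv⁺-contracts f f⁺@(d , f-d , _) g g⁺@(e , g-e , _) {m} f-g≼m =
  ≼-resp (≋-sym eq) (≼-mono
    (ℤ.+-monoˡ-≤ m {y = -1ℤ} (ℤ.-≤- ℕ.z≤n))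
    (≼-⊗ (≼-⊗ (inv⁺-≼ f f⁺) (inv⁺-≼ g g⁺)) (⊖-≼-sym f-g≼m)))
  where
  open ≋-Reasoning
  1/f = inv⁺ f f⁺
  1/g = inv⁺ g g⁺
  eq : 1/f ⊖ 1/g ≋ (1/f ⊗ 1/g) ⊗ (g ⊖ f)
  eq = begin
    1/f ⊖ 1/g                                 ≈⟨ ⊖-cong (R.*-identityʳ 1/f) (R.*-identityʳ 1/g) ⟨
    1/f ⊗ 1# ⊖ 1/g ⊗ 1#                       ≈⟨ ⊖-cong (⊗-congˡ 1/f (≋-trans (⊗-comm 1/g g) (⊗-inverse g (e , g-e))))
                                                        (⊗-congˡ 1/g (≋-trans (⊗-comm 1/f f) (⊗-inverse f (d , f-d)))) ⟨
    1/f ⊗ (1/g ⊗ g) ⊖ 1/g ⊗ (1/f ⊗ f)         ≈⟨ ⊖-cong (⊗-assoc 1/f 1/g g)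
                                                        (≋-trans (⊗-congʳ f (⊗-comm 1/f 1/g)) (⊗-assoc 1/g 1/f f)) ⟨
    (1/f ⊗ 1/g) ⊗ g ⊖ (1/f ⊗ 1/g) ⊗ f         ≈⟨ ⊗-distribˡ-⊖ (1/f ⊗ 1/g) g f ⟨
    (1/f ⊗ 1/g) ⊗ (g ⊖ f)                     ∎

inv-tail-≼ : ∀ c n → inv⁺ (proj₁ (tail c n)) (proj₂ (tail c n)) ≼ -1ℤ
inv-tail-≼ c n = inv⁺-≼ (proj₁ (tail c n)) (proj₂ (tail c n))

-- The two tails differ by a term of degree at most -1 at the innermost level, and each of the n
-- enclosing inversions gains a further degree.
tail-cauchy : ∀ c n → proj₁ (tail c n) ⊖ proj₁ (tail c (suc n)) ≼ ℤ.- + suc n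
tail-cauchy c zero    = ⊕-close (inv-tail-≼ (c ∘ suc) 0)
tail-cauchy c (suc n) = ≼-resp (≋-sym (⊖-⊕-cancelˡ (ι (proj₁ (c 0))) _ _))
  (inv⁺-contracts _ (proj₂ (tail (c ∘ suc) n)) _ (proj₂ (tail (c ∘ suc) (suc n)))
    (tail-cauchy (c ∘ suc) n))

convergent-cauchy : ∀ c₀ c n → convergent c₀ c n ⊖ convergent c₀ c (suc n) ≼ ℤ.- + n
convergent-cauchy c₀ c zero    = ≼-mono ℤ.-≤+ (⊕-close (inv-tail-≼ c 0))
convergent-cauchy c₀ c (suc n) = ≼-resp (≋-sym (⊖-⊕-cancelˡ (ι c₀) _ _))
  (≼-mono (ℤ.-≤- (ℕ.n≤1+n n))
    (inv⁺-contracts _ (proj₂ (tail c n)) _ (proj₂ (tail c (suc n))) (tail-cauchy c n)))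

convergent-close : ∀ c₀ c n → convergent c₀ c n ⊖ ι c₀ ≼ -1ℤ
convergent-close c₀ c zero    = ≋⇒⊖-≼ (≋-refl {ι c₀})
convergent-close c₀ c (suc n) = ⊖-≼-sym (⊕-close (inv-tail-≼ c n))

convergent-≼ : ∀ c₀ c n → convergent c₀ c n ≼ + length c₀
convergent-≼ c₀ c n =
  ≼-close (⊖-≼-sym (≼-mono ℤ.-≤+ (convergent-close c₀ c n))) (≼-top (ι c₀))

-- Completeness with an explicit rate, so that the digits of the limit can be computed; the common
-- bound t becomes its `top`.
module _ (x : ℕ → Laurent) (t : ℤ) (x≼t : ∀ n → x n ≼ t)
         (cauchy : ∀ n → x n ⊖ x (suc n) ≼ ℤ.- + n) where

  private
    stable : ∀ m k → x m ⊖ x (k ℕ.+ m) ≼ ℤ.- + m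
    stable m zero    = ≋⇒⊖-≼ (≋-refl {x m})
    stable m (suc k) = ⊖-≼-trans (stable m k)
      (≼-mono (ℤ.neg-mono-≤ (ℤ.+≤+ (ℕ.m≤n+m m k))) (cauchy (k ℕ.+ m)))

    agree-≤ : ∀ {m n j} → m ℕ.≤ n → ℤ.- + m ℤ.< j → coeff (x m) j ≡ coeff (x n) j
    agree-≤ {m} {n} {j} m≤n -m<j = trans (⊖-≼⇒≡ (stable m (n ℕ.∸ m)) -m<j)
      (cong (λ i → coeff (x i) j) (ℕ.m∸n+n≡m m≤n))

    agree : ∀ m n {j} → ℤ.- + m ℤ.< j → ℤ.- + n ℤ.< j → coeff (x m) j ≡ coeff (x n) j
    agree m n -m<j -n<j with ℕ.≤-total m n
    ... | inj₁ m≤n = agree-≤ m≤n -m<j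
    ... | inj₂ n≤m = sym (agree-≤ n≤m -n<j)

    -- By this index the coefficient of T^j has become stationary.
    index : ℤ → ℕ
    index j = suc ∣ j ∣

    -index<j : ∀ j → ℤ.- + index j ℤ.< j
    -index<j j = <-by (-∣i∣≤i j) (eq j (+ ∣ j ∣))
      where
      eq : ∀ j n → j ℤ.- (1ℤ ℤ.+ (ℤ.- (1ℤ ℤ.+ n))) ≡ j ℤ.- (ℤ.- n)
      eq = solve-∀

  limit : Laurent
  limit = laurent t λ n → coeff (x (index (t ℤ.- + n))) (t ℤ.- + n)

  converges : ConvergesTo x limit
  converges m = ∣ m ∣ , λ n ∣m∣≤n → above (≼-mono
    (ℤ.≤-trans (ℤ.neg-mono-≤ (ℤ.+≤+ ∣m∣≤n)) (-∣i∣≤i m))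
    (≡⇒⊖-≼ {x n} {limit} λ j -n<j → trans (agree n (index j) -n<j (-index<j j))
      (sym (coeff-tabulate (λ j → coeff (x (index j)) j) t (λ j → above (x≼t (index j)) j) j))))

continuedFraction : Poly → (ℕ → Poly⁺) → Laurent
continuedFraction c₀ c = limit (convergent c₀ c) (+ length c₀)
  (convergent-≼ c₀ c) (convergent-cauchy c₀ c)

isContinuedFraction : ∀ c₀ c → IsContinuedFraction c₀ c (continuedFraction c₀ c)
isContinuedFraction c₀ c = converges (convergent c₀ c) (+ length c₀)
  (convergent-≼ c₀ c) (convergent-cauchy c₀ c)

-- Stated for any limit x, since a proof of `IsL` brings its own λᵢ.
continuedFraction-close : ∀ c₀ c x → IsContinuedFraction c₀ c x → x ⊖ ι c₀ ≼ -1ℤ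
continuedFraction-close c₀ c x conv =
  let N , close = conv -1ℤ in
  ⊖-≼-trans (⊖-≼-sym (mk≼ {convergent c₀ c N ⊖ x} (close N ℕ.≤-refl))) (convergent-close c₀ c N)

ι[]≋0# : ι [] ≋ 0#
ι[]≋0# .at j = trans (coeff-ι [] j) (trans (digitAt-0 j) (sym (coeff-0# j)))

fractional-≼ : ∀ c x → IsContinuedFraction [] c x → x ≼ -1ℤ
fractional-≼ c x conv = ≼-close (⊖-≼-sym (continuedFraction-close [] c x conv))
  (mk≼ λ j _ → trans (at ι[]≋0# j) (coeff-0# j))

degree⁺ : Poly⁺ → ℤ
degree⁺ = proj₁ ∘ proj₂

degree⁺-degree : ∀ g → Degree (ι (proj₁ g)) (degree⁺ g)
degree⁺-degree (_ , _ , g-d , _) = mkDegree g-d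

1≤degree⁺ : ∀ g → 1ℤ ℤ.≤ degree⁺ g
1≤degree⁺ (_ , _ , _ , 1≤d) = 1≤d

-- The number [0, c(0), c(1), …].
fractional : (ℕ → Poly⁺) → Laurent
fractional = continuedFraction []

fractional≼-1 : ∀ c → fractional c ≼ -1ℤ
fractional≼-1 c = fractional-≼ c (fractional c) (isContinuedFraction [] c)

-- The equation is exact for convergents and passes to the limit by continuity: α(C + α′) is
-- compared with a(C + α′), and that with a(C + b) = 1.
fractional-step : ∀ c → fractional c ⊗ (ι (proj₁ (c 0)) ⊕ fractional (c ∘ suc)) ≋ 1#
fractional-step c = ⊖-≼⇒≋ λ m →
  let d       = degree⁺ (c 0)
      -- The factor C + α′ of degree d will cost d degrees of precision.
      N₁ , conv₁ = isContinuedFraction [] c (m ℤ.- d)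
      N₂ , conv₂ = isContinuedFraction [] (c ∘ suc) m
      N       = N₁ ℕ.+ N₂
      -- One level deeper than b, so that a = 1/(C + b) holds exactly.
      a       = convergent [] c (suc (suc N))
      b       = convergent [] (c ∘ suc) (suc N)
      y , y⁺  = tail c (suc N)
      1/y     = inv⁺ y y⁺
      a≋1/y : a ≋ 1/y
      a≋1/y = ≋-trans (⊕-cong ι[]≋0# ≋-refl) (⊕-identityˡ 1/y)
      y≋C+b : y ≋ C ⊕ b
      y≋C+b = ⊕-cong (≋-refl {C}) (≋-sym (≋-trans (⊕-cong ι[]≋0# ≋-refl) (⊕-identityˡ _)))
      a[C+b]≋1 : a ⊗ (C ⊕ b) ≋ 1#
      a[C+b]≋1 = ≋-trans (⊗-cong a≋1/y (≋-sym y≋C+b))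
        (≋-trans (⊗-comm 1/y y) (⊗-inverse y (proj₁ y⁺ , proj₁ (proj₂ y⁺))))
      α-a≼ : α ⊖ a ≼ m ℤ.- d
      α-a≼ = ⊖-≼-sym (mk≼ {a ⊖ α} (conv₁ (suc (suc N))
        (ℕ.m≤n⇒m≤1+n (ℕ.m≤n⇒m≤1+n (ℕ.m≤m+n N₁ N₂)))))
      α′-b≼ : α′ ⊖ b ≼ m
      α′-b≼ = ⊖-≼-sym (mk≼ {b ⊖ α′} (conv₂ (suc N) (ℕ.m≤n⇒m≤1+n (ℕ.m≤n+m N₂ N₁))))
      C+α′≼d : C ⊕ α′ ≼ d
      C+α′≼d = ≼-⊕ (degree-≼ (degree⁺-degree (c 0)))
        (≼-mono (ℤ.≤-trans ℤ.-≤+ (1≤degree⁺ (c 0))) (fractional≼-1 (c ∘ suc)))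
      a≼0 : a ≼ 0ℤ
      a≼0 = ≼-resp (≋-sym a≋1/y) (≼-mono ℤ.-≤+ (inv⁺-≼ y y⁺))
  in ⊖-≼-trans
       (≼-resp (⊗-distribʳ-⊖ (C ⊕ α′) α a) (subst ((α ⊖ a) ⊗ (C ⊕ α′) ≼_) (eq m d) (≼-⊗ α-a≼ C+α′≼d)))
       (⊖-≼-trans
         (≼-resp (⊗-distribˡ-⊖ a (C ⊕ α′) (C ⊕ b)) (subst (a ⊗ ((C ⊕ α′) ⊖ (C ⊕ b)) ≼_) (ℤ.+-identityˡ m)
           (≼-⊗ a≼0 (≼-resp (≋-sym (⊖-⊕-cancelˡ C α′ b)) α′-b≼))))
         (≋⇒⊖-≼ a[C+b]≋1))
  where
  C = ι (proj₁ (c 0))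
  α = fractional c
  α′ = fractional (c ∘ suc)
  eq : ∀ m d → m ℤ.- d ℤ.+ d ≡ m
  eq = solve-∀

-- Approximations along a continued fraction

module FractionalStep (c : ℕ → Poly⁺) =
  Reciprocal {fractional c} {fractional (c ∘ suc)} (fractional-step c) (polynomial-ι (proj₁ (c 0)))
    (degree⁺-degree (c 0)) (1≤degree⁺ (c 0)) (fractional≼-1 (c ∘ suc))

approximates-mono : ∀ {α k l} r → k ℤ.≤ l → Approximates α l r → Approximates α k r
approximates-mono {α} r k≤l α≈r = above (≼-mono
  (ℤ.+-monoʳ-≤ (ℤ.- (+ 2 ℤ.* degDen r)) (ℤ.neg-mono-≤ k≤l)) (mk≼ {α ⊖ value r} α≈r))

-- The n-th convergent.
fractional-approximated : ∀ n c k → 1ℤ ℤ.≤ k → k ℤ.≤ degree⁺ (c n) →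
  ∃ λ r → + n ℤ.≤ degDen r × Approximates (fractional c) k r
fractional-approximated zero    c k 1≤k k≤d = 0/1 , ℤ.≤-refl ,
  zero-approximates (fractional c) k (≼-mono (ℤ.neg-mono-≤ k≤d)
    (degree-≼ (FractionalStep.degree-reciprocal c)))
fractional-approximated (suc n) c k 1≤k k≤d =
  let r , n≤e , α′≈r = fractional-approximated n (c ∘ suc) k 1≤k k≤d
      r′ , e′≡d+e , lift = FractionalStep.lift-approximation c r
        (approximates-mono {fractional (c ∘ suc)} r 1≤k α′≈r)
  in r′ , subst (_ ℤ.≤_) (sym e′≡d+e) (ℤ.+-mono-≤ (1≤degree⁺ (c 0)) n≤e) , lift k α′≈r

-- Lowering keeps the quality m and takes at least 1 from deg q, so after at most N + 1 steps the
-- denominator would have negative degree. Only the first N + 1 partial quotients are met, which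
-- makes the lemma applicable to unbounded sequences too.
fractional-not-approximated : ∀ N c m → (∀ i → i ℕ.≤ N → degree⁺ (c i) ℤ.< m) →
  ∀ r → degDen r ℤ.≤ + N → ¬ Approximates (fractional c) m r
fractional-not-approximated N c m d<m r e≤N α≈r =
  let r′ , e′≡e-d , α′≈r′ = FractionalStep.lower-approximation c m (d<m 0 ℕ.z≤n) r α≈r
  in descend N d<m e≤N r′
       (≤-by (ℤ.+-mono-≤ (1≤degree⁺ (c 0)) (ℤ.≤-reflexive e′≡e-d)) (eq (degDen r) (degree⁺ (c 0)) (degDen r′)))
       α′≈r′
  where
  eq : ∀ e d e′ → e ℤ.- (1ℤ ℤ.+ e′) ≡ d ℤ.+ (e ℤ.- d) ℤ.- (1ℤ ℤ.+ e′)
  eq = solve-∀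
  descend : ∀ N → (∀ i → i ℕ.≤ N → degree⁺ (c i) ℤ.< m) → degDen r ℤ.≤ + N →
            ∀ r′ → 1ℤ ℤ.+ degDen r′ ℤ.≤ degDen r → ¬ Approximates (fractional (c ∘ suc)) m r′
  descend zero    _   e≤0 r′ 1+e′≤e _ = contradiction (ℤ.≤-trans 1+e′≤e e≤0)
    (ℤ.<⇒≱ (ℤ.<-≤-trans (ℤ.+<+ (ℕ.s≤s ℕ.z≤n)) (ℤ.+-monoʳ-≤ 1ℤ
      (polynomial-degree (polynomial-ι (den r′)) (mkDegree (proj₂ (den≢0 r′)))))))
  descend (suc N) d<m e≤N r′ 1+e′≤e = fractional-not-approximated N (c ∘ suc) m
    (λ i i≤N → d<m (suc i) (ℕ.s≤s i≤N)) r′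
    (≤-by (ℤ.≤-trans 1+e′≤e e≤N) (eq₁ (+ N) (degDen r′)))
    where
    eq₁ : ∀ n e → n ℤ.- e ≡ 1ℤ ℤ.+ n ℤ.- (1ℤ ℤ.+ e)
    eq₁ = solve-∀

degrees-bounded : ∀ c N → ∃ λ m → ∀ i → i ℕ.≤ N → degree⁺ (c i) ℤ.< m
degrees-bounded c zero    = 1ℤ ℤ.+ degree⁺ (c 0) , λ where
  zero _ → ℤ.suc[i]≤j⇒i<j ℤ.≤-refl
degrees-bounded c (suc N) =
  let m , d<m = degrees-bounded (c ∘ suc) N
      d = 1ℤ ℤ.+ degree⁺ (c 0)
  in d ℤ.⊔ m , λ where
    zero    _           → ℤ.suc[i]≤j⇒i<j (ℤ.i≤i⊔j d m)
    (suc i) (ℕ.s≤s i≤N) → ℤ.<-≤-trans (d<m i i≤N) (ℤ.i≤j⊔i d m)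

-- A value of a fraction is approximated by that fraction with every quality, in particular with one
-- above the degrees of the finitely many partial quotients that its denominator can reach.
fractional-irrational : ∀ c → ¬ Rational (fractional c)
fractional-irrational c (r , α≈r) =
  let m , d<m = degrees-bounded c ∣ degDen r ∣ in
  fractional-not-approximated ∣ degDen r ∣ c m d<m r (i≤∣i∣ (degDen r))
    (rational⇒approximates {fractional c} r α≈r m)

-- Irrational series with prescribed Lagrange value

monomial : ℕ → Poly
monomial zero    = 1ℚ ∷ []
monomial (suc n) = 0ℚ ∷ monomial n

polyCoeff-monomial : ∀ n → polyCoeff (monomial n) n ≡ 1ℚ
polyCoeff-monomial zero    = refl
polyCoeff-monomial (suc n) = polyCoeff-monomial n

length-monomial : ∀ n → length (monomial n) ≡ suc n
length-monomial zero    = refl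
length-monomial (suc n) = cong suc (length-monomial n)

T^1+_ : ℕ → Poly⁺
T^1+ n = p , + suc n , ((λ eq → ℚ.1≢0 (trans (sym lead) eq)) , higher) , ℤ.+≤+ (ℕ.s≤s ℕ.z≤n)
  where
  p = monomial (suc n)
  lead : coeff (ι p) (+ suc n) ≡ 1ℚ
  lead = trans (coeff-ι p (+ suc n)) (polyCoeff-monomial (suc n))
  higher : Deg≤ (ι p) (+ suc n)
  higher (+ j) (ℤ.+<+ n<j) = trans (coeff-ι p (+ j))
    (polyCoeff-above p j (subst (ℕ._≤ j) (sym (length-monomial (suc n))) n<j))

1+∣z∣≰z : ∀ z → ¬ (+ suc ∣ z ∣ ℤ.≤ z)
1+∣z∣≰z z 1+∣z∣≤z = ℕ.<-irrefl refl (ℤ.drop‿+≤+ (ℤ.≤-trans 1+∣z∣≤z (i≤∣i∣ z)))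

lagrange-finite : ∀ n → LagrangeSpectrum [ + suc n ]
lagrange-finite n = fractional c , fractional-irrational c , bounded , λ w w-bound →
  w-bound (+ suc n) (infinitely-many (fractional c) (fractional-irrational c) λ i none →
    none (fractional-approximated i c (+ suc n) (ℤ.+≤+ (ℕ.s≤s ℕ.z≤n)) ℤ.≤-refl))
  where
  c : ℕ → Poly⁺
  c = const (T^1+ n)
  bounded : ∀ k → InfinitelyMany (Approximates (fractional c) k) → [ k ] ≤⁺ [ + suc n ]
  -- Beyond quality n + 1 there is no approximation at all, so the empty list covers them.
  bounded k infinite = [ ℤ.≮⇒≥ (λ n<k → infinite ([] , λ r α≈r → contradiction α≈r
    (fractional-not-approximated ∣ degDen r ∣ c k (λ _ _ → n<k) r (i≤∣i∣ (degDen r))))) ]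

lagrange-infinite : LagrangeSpectrum ⊤⁺
lagrange-infinite = fractional T^1+_ , fractional-irrational T^1+_ , (λ k _ → [ k ] ≤⊤⁺) , least
  where
  infinite : ∀ k → InfinitelyMany (Approximates (fractional T^1+_) (+ suc k))
  infinite k = infinitely-many (fractional T^1+_) (fractional-irrational T^1+_) λ n none →
    -- One index n + k serves twice: its partial quotient has degree n + k + 1 ≥ k + 1, and the
    -- denominator has degree at least n.
    let r , n+k≤e , α≈r = fractional-approximated (n ℕ.+ k) T^1+_ (+ suc k)
          (ℤ.+≤+ (ℕ.s≤s ℕ.z≤n)) (ℤ.+≤+ (ℕ.s≤s (ℕ.m≤n+m k n)))
    in none (r , ℤ.≤-trans (ℤ.+≤+ (ℕ.m≤m+n n k)) n+k≤e , α≈r)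
  least : ∀ w → (∀ k → InfinitelyMany (Approximates (fractional T^1+_) k) → [ k ] ≤⁺ w) → ⊤⁺ ≤⁺ w
  least ⊤⁺    _       = ⊤⁺ ≤⊤⁺
  least [ z ] w-bound =
    contradiction ([≤]-injective (w-bound (+ suc ∣ z ∣) (infinite ∣ z ∣))) (1+∣z∣≰z z)

-- Doubly infinite sequences with prescribed limsup

module _ (A : ℤ → Poly⁺) (i : ℤ) where

  private
    after before : ℕ → Poly⁺
    after  n = A (i ℤ.+ + suc n)
    before n = A (i ℤ.- + suc n)

  λ-degree : ∀ s → Isλ A i s → Degree s (degree⁺ (A i))
  λ-degree s (x , y , x-cf , y-cf , s≈x+y) = degree-close (⊖-≼-sym s-g≼-1)
    (ℤ.<-≤-trans ℤ.-<+ (1≤degree⁺ (A i))) (degree⁺-degree (A i))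
    where
    g = ι (proj₁ (A i))
    s-g≼-1 : s ⊖ g ≼ -1ℤ
    s-g≼-1 = ⊖-≼-trans (≋⇒⊖-≼ {s} {x ⊕ y} (mk≋ s≈x+y)) (⊖-≼-trans
      (⊖-≼-sym (⊕-close {x} {y} (fractional-≼ before y y-cf)))
      (continuedFraction-close (proj₁ (A i)) after x x-cf))

  λ-value : Laurent
  λ-value = continuedFraction (proj₁ (A i)) after ⊕ fractional before

  isλ-value : Isλ A i λ-value
  isλ-value = continuedFraction (proj₁ (A i)) after , fractional before ,
    isContinuedFraction (proj₁ (A i)) after , isContinuedFraction [] before , λ _ → refl

  λ-value-degree : Degree λ-value (degree⁺ (A i))
  λ-value-degree = λ-degree λ-value isλ-value

L-finite : ∀ n → ∃ λ A → IsL A [ + suc n ]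
L-finite n = A , λ-value A , isλ-value A ,
  (λ k (N , s≤k) → [ degree-≤ (λ-value-degree A (+ N)) (mk≼ (s≤k (+ N) ℕ.≤-refl)) ]) ,
  (λ w w-bound → w-bound (+ suc n) (0 , λ i _ → above (degree-≼ (λ-value-degree A i))))
  where
  A : ℤ → Poly⁺
  A = const (T^1+ n)

L-infinite : ∃ λ A → IsL A ⊤⁺
L-infinite = A , λ-value A , isλ-value A ,
  -- The index N + |k| lies in the range of the eventual bound, and its λ has degree N + |k| + 1 >
  -- k.
  (λ k (N , s≤k) → contradiction
    (ℤ.≤-trans (ℤ.+≤+ (ℕ.s≤s (ℕ.m≤n+m ∣ k ∣ N)))
      (degree-≤ (λ-value-degree A (+ (N ℕ.+ ∣ k ∣))) (mk≼ (s≤k (+ (N ℕ.+ ∣ k ∣)) (ℕ.m≤m+n N ∣ k ∣)))))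
    (1+∣z∣≰z k)) ,
  (λ w _ → w ≤⊤⁺)
  where
  A : ℤ → Poly⁺
  A i = T^1+ ∣ i ∣

-- Comparison of the two sets

1≤lagrange : ∀ k → LagrangeSpectrum [ k ] → 1ℤ ℤ.≤ k
1≤lagrange k (α , α-irr , bounded , _) =
  [≤]-injective (bounded 1ℤ (infinitely-many α {1ℤ} α-irr (dirichlet {α} α-irr)))

1≤L : ∀ k A → IsL A [ k ] → 1ℤ ℤ.≤ k
1≤L k A (s , s-λ , _ , greatest) =
  -- The limsup is the greatest lower bound of the eventual bounds, and each of them is tested at
  -- the index N where it takes effect.
  [≤]-injective (greatest [ 1ℤ ] λ k (N , s≤k) → [ ℤ.≤-trans (1≤degree⁺ (A (+ N)))
    (degree-≤ (λ-degree A (+ N) (s (+ N)) (s-λ (+ N))) (mk≼ (s≤k (+ N) ℕ.≤-refl))) ])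

theorem9 : LagrangeSpectrum ≐ (λ v → ∃ λ (A : ℤ → Poly⁺) → IsL A v)
theorem9 = to , from
  where
  L-value : ∀ {k} → 1ℤ ℤ.≤ k → ∃ λ A → IsL A [ k ]
  L-value {+ suc n} _         = L-finite n
  L-value {+ zero}  (ℤ.+≤+ ())

  lagrange-value : ∀ {k} → 1ℤ ℤ.≤ k → LagrangeSpectrum [ k ]
  lagrange-value {+ suc n} _         = lagrange-finite n
  lagrange-value {+ zero}  (ℤ.+≤+ ())

  to : ∀ {v} → LagrangeSpectrum v → ∃ λ A → IsL A v
  to {⊤⁺}    _          = L-infinite
  to {[ k ]} k-lagrange = L-value (1≤lagrange k k-lagrange)

  from : ∀ {v} → (∃ λ A → IsL A v) → LagrangeSpectrum v
  from {⊤⁺}    _         = lagrange-infinite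
  from {[ k ]} (A , k-L) = lagrange-value (1≤L k A k-L)
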